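{- Let $PD(n)$ denote the number of partitions of $n$ with designated summands. Then, as formal power series in $q$ (equivalently for $|q|<1$), $$\sum_{n=0}^{\infty} PD(3n+2)q^n = 3\,\frac{(q^3;q^6)_\infty^3\,(q^6;q^6)_\infty^6}{(q;q^2)_\infty^5\,(q^2;q^2)_\infty^8}.$$
   Context: A partition of $n$ with designated summands is an ordinary partition of $n$ in which, for each part size that occurs, exactly one of the parts of that size is designated (marked); if a size $t$ occurs $m_t$ times, the copies of $t$ are regarded as ordered and the designation may be placed on any one of the $m_t$ positions, different positions giving different objects (e.g. $2'+2$ and $2+2'$ are distinct). $PD(n)$ is the number of such objects, with $PD(0)=1$. Notation: $(a;q)_\infty=\prod_{n\ge1}(1-aq^{n-1})$. -}

module Defs where

open import Data.Nat using (ℕ; zero; suc; _≤?_; _≟_) renaming (_+_ to _+ℕ_; _*_ to _*ℕ_; _∸_ to _∸ℕ_)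
open import Data.Integer using (ℤ; +_; _+_; _*_; -_)
open import Data.List using (List; []; _∷_)
open import Relation.Nullary using (yes; no)

-- PD(n): partitions of n with designated summands.
-- A partition is determined by the multiplicity m_t of each part size t.
-- For each size t occurring (m_t ≥ 1) there are m_t ways to designate one
-- of its copies; a size not occurring contributes factor 1.
-- PDle n k = number of designated-summand partitions of n with all parts ≤ k.

weight : ℕ → ℕ
weight zero    = 1
weight (suc m) = suc m

PDle : ℕ → ℕ → ℕ
PDsum : ℕ → ℕ → ℕ → ℕ → ℕ

PDle zero    zero    = 1
PDle (suc _) zero    = 0
PDle n       (suc k) = PDsum n (suc k) k n

PDsum n t k zero = PDle n k
PDsum n t k (suc b) with (suc b *ℕ t) ≤? n
... | yes _ = weight (suc b) *ℕ PDle (n ∸ℕ (suc b *ℕ t)) k +ℕ PDsum n t k b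
... | no  _ = PDsum n t k b

PD : ℕ → ℕ
PD n = PDle n n

Series : Set
Series = ℕ → ℤ

sumTo : ℕ → (ℕ → ℤ) → ℤ
sumTo zero    f = + 0
sumTo (suc n) f = sumTo n f + f n

_⊛_ : Series → Series → Series
(a ⊛ b) n = sumTo (suc n) (λ i → a i * b (n ∸ℕ i))

infixl 7 _⊛_

scale : ℤ → Series → Series
scale c a n = c * a n

oneS : Series
oneS zero    = + 1
oneS (suc _) = + 0

oneMinusQ : ℕ → Series
oneMinusQ e n with n ≟ 0 | n ≟ e
... | yes _ | yes _ = + 0
... | yes _ | no  _ = + 1
... | no  _ | yes _ = - (+ 1)
... | no  _ | no  _ = + 0

finPoch : ℕ → ℕ → ℕ → Series
finPoch a d zero    = oneS
finPoch a d (suc N) = finPoch a d N ⊛ oneMinusQ (a +ℕ N *ℕ d)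

-- (q^a ; q^d)_∞ for a ≥ 1, d ≥ 1: the coefficient of q^n is that of the
-- finite product of the first n+1 factors (every later factor is
-- 1 - q^e with e > n, hence ≡ 1 mod q^{n+1}).
poch : ℕ → ℕ → Series
poch a d n = finPoch a d (suc n) n

_^S_ : Series → ℕ → Series
a ^S zero  = oneS
a ^S suc k = a ^S k ⊛ a

-- Multiplicative inverse of a series with constant term 1:
-- b_0 = 1, b_{n} = - Σ_{k=1}^{n} a_k b_{n-k}.
-- invList a n = [b_n , b_{n-1} , … , b_0]
dot : Series → ℕ → List ℤ → ℤ
dot a k []       = + 0
dot a k (x ∷ xs) = a k * x + dot a (suc k) xs

invList : Series → ℕ → List ℤ
invList a zero    = + 1 ∷ []
invList a (suc n) = (- dot a 1 (invList a n)) ∷ invList a n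

inv : Series → Series
inv a n with invList a n
... | []    = + 0
... | x ∷ _ = x

{-# OPTIONS --safe #-}
module Submission where

-- Write E_m = (q^m; q^m)_∞. The generating function of PD is
-- E_6 / (E_1 E_2 E_3), and E_3, E_6 are series in q³, so everything depends on
-- the 3-dissection f = a(q³) + q b(q³) + q² c(q³) of f = E_1 E_2. Multiplying
-- f by its cofactor in the cubic norm a³ + q b³ + q² c³ - 3 q a b c gives the
-- norm at q³; the part of the cofactor with exponents ≡ 2 (mod 3) is b² - a c,
-- and the norm of f, computed factor by factor, is E_1⁴ E_2⁴ / (E_3 E_6).
-- To find b² - a c, write f = φ(-q) ψ(q). By the Jacobi triple product,
-- φ(-q) = φ(-q⁹) - 2 q Ω(q³) and ψ(q) = A(q³) + q ψ(q⁹), with Ω A = E_3 E_6.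
-- Hence b² - a c = s² + s t + t² for s = φ(-q³) ψ(q³) = E_3 E_6 and
-- t = -2 Ω A = -2 s, that is 3 E_3² E_6².

open import Defs
open import Data.Nat using (ℕ; _+_; _*_)
open import Data.Integer using (+_)
open import Relation.Binary.PropositionalEquality using (_≡_)

open import Data.Nat using (zero; suc; z≤n; s≤s; _≤_; _<_; _∸_)
import Data.Nat.Properties as ℕₚ
open import Data.Integer using (ℤ; -[1+_]) renaming (_+_ to _+ℤ_; _*_ to _*ℤ_; -_ to -ℤ_)
import Data.Integer.Properties as ℤₚ
open import Data.Integer.Solver using (module +-*-Solver)
open import Data.Maybe using (Maybe; just; nothing)
open import Data.Product using (_×_; _,_; proj₁; proj₂; Σ)
open import Data.Vec as Vec using (Vec; []; _∷_)
open import Data.Vec.N-ary using (N-ary; _$ⁿ_; curryⁿ; ∀ⁿ; uncurry-∀ⁿ; left-inverse)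
open import Data.Vec.Relation.Binary.Pointwise.Inductive as Pointwise using (Pointwise; []; _∷_)
open import Algebra.Bundles using (CommutativeRing)
import Algebra.Solver.Ring as RingSolver
open import Algebra.Solver.Ring.AlmostCommutativeRing using (fromCommutativeRing; _-Raw-AlmostCommutative⟶_)
open import Algebra.Structures using (IsCommutativeRing)
open import Function using (_∘_)
open import Function.Bundles using (Equivalence)
open import Level using (0ℓ)
open import Relation.Binary using (Setoid; IsEquivalence)
open import Relation.Binary.PropositionalEquality using (refl; sym; trans; cong; cong₂; subst; module ≡-Reasoning)
import Relation.Binary.Reasoning.Setoid as SetoidReasoning
open import Relation.Nullary using (yes; no; ¬_; contradiction)

-- Each size t contributes 1 + Σ m y^m = (1 - y + y²)/(1 - y)² with y = q^t, and (1 - y + y²)(1 -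
-- y²)(1 - y³) = (1 - y)(1 - y⁶); this is where the quotient of the E_m comes from. Behind the cubic
-- norm stands the product f(q) f(ωq) f(ω²q) over the cube roots of unity. All coefficients stay
-- integers, so ω itself never appears: norm and cofactor are polynomials in a, b, c, and
-- multiplication by q^e only scales these parts or shifts them cyclically. The basic identities
-- between infinite products are obtained from finite ones modulo every q^K. In the theta functions
-- the negative powers of u are replaced by powers of a second parameter v with u v = Q. This admits
-- u = -1, v = -q, which yields 2ψ(q); the discriminant is therefore found for 2f and divided by 4
-- at the end.

module ZS = +-*-Solver

-- The ring of formal power series

infix 4 _≈_
-- A record rather than a bare pointwise equality, so that unification can recover both series from
-- a proof.
record _≈_ (a b : Series) : Set where
  constructor mk≈
  field at : ∀ n → a n ≡ b n
open _≈_ public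

zeroS : Series
zeroS _ = + 0

tail : Series → Series
tail a n = a (suc n)

constS : ℤ → Series
constS c zero    = c
constS c (suc _) = + 0

sumTo-cong : ∀ n {f g : ℕ → ℤ} → (∀ i → i < n → f i ≡ g i) → sumTo n f ≡ sumTo n g
sumTo-cong zero    h = refl
sumTo-cong (suc n) h = cong₂ _+ℤ_ (sumTo-cong n (λ i p → h i (ℕₚ.m<n⇒m<1+n p))) (h n (ℕₚ.n<1+n n))

sumTo-suc : ∀ n (f : ℕ → ℤ) → sumTo (suc n) f ≡ f 0 +ℤ sumTo n (λ i → f (suc i))
sumTo-suc zero    f = ℤₚ.+-comm (+ 0) (f 0)
sumTo-suc (suc n) f = trans (cong (_+ℤ f (suc n)) (sumTo-suc n f)) (ℤₚ.+-assoc (f 0) _ _)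

infixl 6 _⊕_
infixl 7 _·_
infix  8 ⊖_

-- The ring operations are opaque because unification would otherwise unfold
-- convolutions to sums of integers.
opaque
  _⊕_ : Series → Series → Series
  (a ⊕ b) n = a n +ℤ b n

  ⊖_ : Series → Series
  (⊖ a) n = -ℤ a n

  _·_ : Series → Series → Series
  _·_ = _⊛_

  ⊕-at : ∀ a b n → (a ⊕ b) n ≡ a n +ℤ b n
  ⊕-at a b n = refl

  ⊖-at : ∀ a n → (⊖ a) n ≡ -ℤ a n
  ⊖-at a n = refl

  ·-zero : ∀ a b → (a · b) 0 ≡ a 0 *ℤ b 0
  ·-zero a b = ℤₚ.+-identityˡ _

  ·-suc : ∀ a b n → (a · b) (suc n) ≡ a 0 *ℤ b (suc n) +ℤ (tail a · b) n
  ·-suc a b n = sumTo-suc (suc n) _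

  ·-sucʳ : ∀ a b n → (a · b) (suc n) ≡ (a · tail b) n +ℤ a (suc n) *ℤ b 0
  ·-sucʳ a b n = cong₂ _+ℤ_
    (sumTo-cong (suc n) (λ i p → cong (λ m → a i *ℤ b m) (ℕₚ.+-∸-assoc 1 (ℕₚ.≤-pred p))))
    (cong (λ m → a (suc n) *ℤ b m) (ℕₚ.n∸n≡0 n))

  ·-cong-≤ : ∀ {a a′ b b′} n → (∀ i → i ≤ n → a i ≡ a′ i) → (∀ i → i ≤ n → b i ≡ b′ i) → (a · b) n ≡ (a′ · b′) n
  ·-cong-≤ n p q = sumTo-cong (suc n) (λ i i≤ → cong₂ _*ℤ_ (p i (ℕₚ.≤-pred i≤)) (q (n ∸ i) (ℕₚ.m∸n≤m n i)))

  -- Peeling the first term of one convolution and the last term of the other leaves the same claim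
  -- at the preceding index, so that no sum has to be reversed.
  ·-comm-at : ∀ n a b → (a · b) n ≡ (b · a) n
  ·-comm-at zero    a b = trans (·-zero a b) (trans (ℤₚ.*-comm (a 0) (b 0)) (sym (·-zero b a)))
  ·-comm-at (suc n) a b = begin
    (a · b) (suc n)                            ≡⟨ ·-suc a b n ⟩
    a 0 *ℤ b (suc n) +ℤ (tail a · b) n         ≡⟨ cong₂ _+ℤ_ (ℤₚ.*-comm (a 0) _) (·-comm-at n (tail a) b) ⟩
    b (suc n) *ℤ a 0 +ℤ (b · tail a) n         ≡⟨ ℤₚ.+-comm (b (suc n) *ℤ a 0) ((b · tail a) n) ⟩
    (b · tail a) n +ℤ b (suc n) *ℤ a 0         ≡⟨ ·-sucʳ b a n ⟨
    (b · a) (suc n)                            ∎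
    where open ≡-Reasoning

  ·-distribʳ-at : ∀ n a b c → ((b ⊕ c) · a) n ≡ (b · a) n +ℤ (c · a) n
  ·-distribʳ-at zero a b c = begin
    ((b ⊕ c) · a) 0                    ≡⟨ ·-zero (b ⊕ c) a ⟩
    (b 0 +ℤ c 0) *ℤ a 0                ≡⟨ ℤₚ.*-distribʳ-+ (a 0) (b 0) (c 0) ⟩
    b 0 *ℤ a 0 +ℤ c 0 *ℤ a 0           ≡⟨ cong₂ _+ℤ_ (·-zero b a) (·-zero c a) ⟨
    (b · a) 0 +ℤ (c · a) 0             ∎
    where open ≡-Reasoning
  ·-distribʳ-at (suc n) a b c = begin
    ((b ⊕ c) · a) (suc n)
      ≡⟨ ·-suc (b ⊕ c) a n ⟩
    (b 0 +ℤ c 0) *ℤ a (suc n) +ℤ ((tail b ⊕ tail c) · a) n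
      ≡⟨ cong ((b 0 +ℤ c 0) *ℤ a (suc n) +ℤ_) (·-distribʳ-at n a (tail b) (tail c)) ⟩
    (b 0 +ℤ c 0) *ℤ a (suc n) +ℤ ((tail b · a) n +ℤ (tail c · a) n)
      ≡⟨ ZS.solve 5 (λ u v w x y → (u ZS.:+ v) ZS.:* w ZS.:+ (x ZS.:+ y) ZS.:= (u ZS.:* w ZS.:+ x) ZS.:+ (v ZS.:* w ZS.:+ y)) refl (b 0) (c 0) (a (suc n)) _ _ ⟩
    (b 0 *ℤ a (suc n) +ℤ (tail b · a) n) +ℤ (c 0 *ℤ a (suc n) +ℤ (tail c · a) n)
      ≡⟨ cong₂ _+ℤ_ (·-suc b a n) (·-suc c a n) ⟨
    (b · a) (suc n) +ℤ (c · a) (suc n) ∎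
    where open ≡-Reasoning

  constS-· : ∀ c a n → (constS c · a) n ≡ c *ℤ a n
  constS-· c a zero    = ·-zero (constS c) a
  constS-· c a (suc n) = begin
    (constS c · a) (suc n)            ≡⟨ ·-suc (constS c) a n ⟩
    c *ℤ a (suc n) +ℤ (zeroS · a) n   ≡⟨ cong (c *ℤ a (suc n) +ℤ_) (zeroS-· n) ⟩
    c *ℤ a (suc n) +ℤ + 0             ≡⟨ ℤₚ.+-identityʳ _ ⟩
    c *ℤ a (suc n)                    ∎
    where
    open ≡-Reasoning
    zeroS-· : ∀ n → (zeroS · a) n ≡ + 0
    zeroS-· zero    = ·-zero zeroS a
    zeroS-· (suc n) = trans (·-suc zeroS a n) (cong (+ 0 +ℤ_) (zeroS-· n))

  tail-· : ∀ a b n → tail (a · b) n ≡ ((constS (a 0) · tail b) ⊕ (tail a · b)) n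
  tail-· a b n = trans (·-suc a b n) (cong (_+ℤ (tail a · b) n) (sym (constS-· (a 0) (tail b) n)))

  constS-·-assoc : ∀ k a b n → ((constS k · a) · b) n ≡ k *ℤ (a · b) n
  constS-·-assoc k a b zero = begin
    ((constS k · a) · b) 0     ≡⟨ ·-zero (constS k · a) b ⟩
    (constS k · a) 0 *ℤ b 0    ≡⟨ cong (_*ℤ b 0) (constS-· k a 0) ⟩
    k *ℤ a 0 *ℤ b 0            ≡⟨ ℤₚ.*-assoc k _ _ ⟩
    k *ℤ (a 0 *ℤ b 0)          ≡⟨ cong (k *ℤ_) (·-zero a b) ⟨
    k *ℤ (a · b) 0             ∎
    where open ≡-Reasoning
  constS-·-assoc k a b (suc n) = begin
    ((constS k · a) · b) (suc n)
      ≡⟨ ·-suc (constS k · a) b n ⟩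
    (constS k · a) 0 *ℤ b (suc n) +ℤ (tail (constS k · a) · b) n
      ≡⟨ cong₂ _+ℤ_ (cong (_*ℤ b (suc n)) (constS-· k a 0))
          (·-cong-≤ {b = b} n (λ i _ → trans (constS-· k a (suc i)) (sym (constS-· k (tail a) i))) (λ _ _ → refl)) ⟩
    k *ℤ a 0 *ℤ b (suc n) +ℤ ((constS k · tail a) · b) n
      ≡⟨ cong (k *ℤ a 0 *ℤ b (suc n) +ℤ_) (constS-·-assoc k (tail a) b n) ⟩
    k *ℤ a 0 *ℤ b (suc n) +ℤ k *ℤ (tail a · b) n
      ≡⟨ ZS.solve 4 (λ x y z w → x ZS.:* y ZS.:* z ZS.:+ x ZS.:* w ZS.:= x ZS.:* (y ZS.:* z ZS.:+ w)) refl k (a 0) (b (suc n)) _ ⟩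
    k *ℤ (a 0 *ℤ b (suc n) +ℤ (tail a · b) n)
      ≡⟨ cong (k *ℤ_) (·-suc a b n) ⟨
    k *ℤ (a · b) (suc n) ∎
    where open ≡-Reasoning

  -- By `tail-·`, `tail` acts on a product like a twisted derivation; the induction on the index
  -- uses this in place of an exchange of double sums.
  ·-assoc-at : ∀ n a b c → ((a · b) · c) n ≡ (a · (b · c)) n
  ·-assoc-at zero a b c = begin
    ((a · b) · c) 0       ≡⟨ ·-zero (a · b) c ⟩
    (a · b) 0 *ℤ c 0      ≡⟨ cong (_*ℤ c 0) (·-zero a b) ⟩
    a 0 *ℤ b 0 *ℤ c 0     ≡⟨ ℤₚ.*-assoc (a 0) _ _ ⟩
    a 0 *ℤ (b 0 *ℤ c 0)   ≡⟨ cong (a 0 *ℤ_) (·-zero b c) ⟨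
    a 0 *ℤ (b · c) 0      ≡⟨ ·-zero a (b · c) ⟨
    (a · (b · c)) 0       ∎
    where open ≡-Reasoning
  ·-assoc-at (suc n) a b c = begin
    ((a · b) · c) (suc n)
      ≡⟨ ·-suc (a · b) c n ⟩
    (a · b) 0 *ℤ c (suc n) +ℤ (tail (a · b) · c) n
      ≡⟨ cong₂ _+ℤ_ (cong (_*ℤ c (suc n)) (·-zero a b)) (·-cong-≤ {b = c} n (λ i _ → tail-· a b i) (λ _ _ → refl)) ⟩
    a 0 *ℤ b 0 *ℤ c (suc n) +ℤ (((constS (a 0) · tail b) ⊕ (tail a · b)) · c) n
      ≡⟨ cong (a 0 *ℤ b 0 *ℤ c (suc n) +ℤ_) (·-distribʳ-at n c (constS (a 0) · tail b) (tail a · b)) ⟩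
    a 0 *ℤ b 0 *ℤ c (suc n) +ℤ (((constS (a 0) · tail b) · c) n +ℤ ((tail a · b) · c) n)
      ≡⟨ cong (a 0 *ℤ b 0 *ℤ c (suc n) +ℤ_) (cong₂ _+ℤ_ (constS-·-assoc (a 0) (tail b) c n) (·-assoc-at n (tail a) b c)) ⟩
    a 0 *ℤ b 0 *ℤ c (suc n) +ℤ (a 0 *ℤ (tail b · c) n +ℤ (tail a · (b · c)) n)
      ≡⟨ ZS.solve 5 (λ x y z u v → x ZS.:* y ZS.:* z ZS.:+ (x ZS.:* u ZS.:+ v) ZS.:= x ZS.:* (y ZS.:* z ZS.:+ u) ZS.:+ v) refl (a 0) (b 0) (c (suc n)) _ _ ⟩
    a 0 *ℤ (b 0 *ℤ c (suc n) +ℤ (tail b · c) n) +ℤ (tail a · (b · c)) n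
      ≡⟨ cong (λ z → a 0 *ℤ z +ℤ (tail a · (b · c)) n) (·-suc b c n) ⟨
    a 0 *ℤ (b · c) (suc n) +ℤ (tail a · (b · c)) n
      ≡⟨ ·-suc a (b · c) n ⟨
    (a · (b · c)) (suc n) ∎
    where open ≡-Reasoning

  oneS≡constS : ∀ n → oneS n ≡ constS (+ 1) n
  oneS≡constS zero    = refl
  oneS≡constS (suc n) = refl

  ·-identityˡ-at : ∀ a n → (oneS · a) n ≡ a n
  ·-identityˡ-at a n = trans (·-cong-≤ {b = a} n (λ i _ → oneS≡constS i) (λ _ _ → refl))
    (trans (constS-· (+ 1) a n) (ℤₚ.*-identityˡ (a n)))

≈-isEquivalence : IsEquivalence _≈_
≈-isEquivalence = record
  { refl  = mk≈ (λ _ → refl)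
  ; sym   = λ p → mk≈ (λ n → sym (at p n))
  ; trans = λ p q → mk≈ (λ n → trans (at p n) (at q n)) }

opaque
  unfolding _·_

  series-isCommutativeRing : IsCommutativeRing _≈_ _⊕_ _·_ ⊖_ zeroS oneS
  series-isCommutativeRing = record
      { isRing = record
        { +-isAbelianGroup = record
          { isGroup = record
            { isMonoid = record
              { isSemigroup = record
                { isMagma = record
                  { isEquivalence = ≈-isEquivalence
                  ; ∙-cong = λ p q → mk≈ (λ n → cong₂ _+ℤ_ (at p n) (at q n)) }
                ; assoc = λ a b c → mk≈ (λ n → ℤₚ.+-assoc (a n) (b n) (c n)) }
              ; identity = (λ a → mk≈ (λ n → ℤₚ.+-identityˡ (a n))) , (λ a → mk≈ (λ n → ℤₚ.+-identityʳ (a n))) }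
            ; inverse = (λ a → mk≈ (λ n → ℤₚ.+-inverseˡ (a n))) , (λ a → mk≈ (λ n → ℤₚ.+-inverseʳ (a n)))
            ; ⁻¹-cong = λ p → mk≈ (λ n → cong -ℤ_ (at p n)) }
          ; comm = λ a b → mk≈ (λ n → ℤₚ.+-comm (a n) (b n)) }
        ; *-cong = λ p q → mk≈ (λ n → ·-cong-≤ n (λ i _ → at p i) (λ i _ → at q i))
        ; *-assoc = λ a b c → mk≈ (λ n → ·-assoc-at n a b c)
        ; *-identity = (λ a → mk≈ (·-identityˡ-at a)) , (λ a → mk≈ (λ n → trans (·-comm-at n a oneS) (·-identityˡ-at a n)))
        ; distrib = (λ a b c → mk≈ (λ n → trans (·-comm-at n a (b ⊕ c)) (trans (·-distribʳ-at n a b c) (cong₂ _+ℤ_ (·-comm-at n b a) (·-comm-at n c a)))))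
                  , (λ a b c → mk≈ (λ n → ·-distribʳ-at n a b c)) }
      ; *-comm = λ a b → mk≈ (λ n → ·-comm-at n a b) }

seriesRing : CommutativeRing 0ℓ 0ℓ
seriesRing = record { isCommutativeRing = series-isCommutativeRing }

module SR = CommutativeRing seriesRing
open SR using () renaming (refl to ≈-refl; sym to ≈-sym; trans to ≈-trans; +-cong to ⊕-cong; *-cong to ·-cong; -‿cong to ⊖-cong; *-assoc to ·-assoc; *-comm to ·-comm; *-identityˡ to ·-identityˡ; *-identityʳ to ·-identityʳ; setoid to ≈-setoid) public

-- Small integer constants are sent to zeroS and oneS on the nose, so that
-- solver output matches goals mentioning those series.
embed : ℤ → Series
embed (+ 0) = zeroS
embed (+ 1) = oneS
embed c     = constS c

embed≈constS : ∀ c → embed c ≈ constS c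
embed≈constS (+ 0)           = mk≈ λ { zero → refl ; (suc _) → refl }
embed≈constS (+ 1)           = mk≈ oneS≡constS
embed≈constS (+ suc (suc _)) = ≈-refl
embed≈constS (-[1+ _ ])      = ≈-refl

opaque
  unfolding _·_

  constS-+ : ∀ a b → constS (a +ℤ b) ≈ constS a ⊕ constS b
  constS-+ a b = mk≈ λ { zero → refl ; (suc _) → refl }

  constS-* : ∀ a b → constS (a *ℤ b) ≈ constS a · constS b
  constS-* a b = mk≈ λ { zero → sym (constS-· a (constS b) 0) ; (suc n) → sym (trans (constS-· a (constS b) (suc n)) (ℤₚ.*-zeroʳ a)) }

  constS-neg : ∀ a → constS (-ℤ a) ≈ ⊖ constS a
  constS-neg a = mk≈ λ { zero → refl ; (suc _) → refl }

embed-morphism : CommutativeRing.rawRing ℤₚ.+-*-commutativeRing -Raw-AlmostCommutative⟶ fromCommutativeRing seriesRing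
embed-morphism = record
  { ⟦_⟧    = embed
  ; +-homo = λ a b → ≈-trans (embed≈constS _) (≈-trans (constS-+ a b) (≈-sym (⊕-cong (embed≈constS a) (embed≈constS b))))
  ; *-homo = λ a b → ≈-trans (embed≈constS _) (≈-trans (constS-* a b) (≈-sym (·-cong (embed≈constS a) (embed≈constS b))))
  ; -‿homo = λ a → ≈-trans (embed≈constS _) (≈-trans (constS-neg a) (≈-sym (⊖-cong (embed≈constS a))))
  ; 0-homo = ≈-refl
  ; 1-homo = ≈-refl }

embed-dec : ∀ a b → Maybe (embed a ≈ embed b)
embed-dec a b with a ℤₚ.≟ b
... | yes refl = just ≈-refl
... | no _     = nothing

module RS = RingSolver (CommutativeRing.rawRing ℤₚ.+-*-commutativeRing) (fromCommutativeRing seriesRing) embed-morphism embed-dec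
open RS using (Polynomial; con; _:+_; _:*_; _:-_; :-_; _:=_) public

close : ∀ {A : Set} n → N-ary n (Polynomial n) A → A
close n f = f $ⁿ Vec.map RS.var (Vec.allFin n)

-- Comparing the closed normal forms is much faster than the library's
-- `solve`, which compares their values in an open environment.
identity : ∀ n (f : N-ary n (Polynomial n) (Polynomial n × Polynomial n)) →
  RS.normalise (proj₁ (close n f)) ≡ RS.normalise (proj₂ (close n f)) →
  ∀ⁿ n (curryⁿ λ ρ → RS.⟦ proj₁ (close n f) ⟧ ρ ≈ RS.⟦ proj₂ (close n f) ⟧ ρ)
identity n f eq = Equivalence.from (uncurry-∀ⁿ n) λ ρ →
  subst (λ P → P) (sym (left-inverse (λ _ → _ ≈ _) ρ))
    (RS.prove ρ (proj₁ (close n f)) (proj₂ (close n f)) (SR.reflexive (cong (λ N → RS.⟦ N ⟧N ρ) eq)))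

-- Congruence modulo a power of q

module ≈-Reasoning = SetoidReasoning ≈-setoid

infix 4 _≈[_]_
record _≈[_]_ (a : Series) (K : ℕ) (b : Series) : Set where
  constructor mk[]
  field at[] : ∀ n → n < K → a n ≡ b n
open _≈[_]_ public

≈⇒[] : ∀ {a b K} → a ≈ b → a ≈[ K ] b
≈⇒[] p = mk[] (λ n _ → at p n)

[]⇒≈ : ∀ {a b} → (∀ K → a ≈[ K ] b) → a ≈ b
[]⇒≈ p = mk≈ (λ n → at[] (p (suc n)) n (ℕₚ.n<1+n n))

[]-refl : ∀ {a K} → a ≈[ K ] a
[]-refl = mk[] (λ _ _ → refl)

[]-sym : ∀ {a b K} → a ≈[ K ] b → b ≈[ K ] a
[]-sym p = mk[] (λ n l → sym (at[] p n l))

[]-trans : ∀ {a b c K} → a ≈[ K ] b → b ≈[ K ] c → a ≈[ K ] c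
[]-trans p q = mk[] (λ n l → trans (at[] p n l) (at[] q n l))

[]-weaken : ∀ {a b K L} → L ≤ K → a ≈[ K ] b → a ≈[ L ] b
[]-weaken h p = mk[] (λ n l → at[] p n (ℕₚ.<-≤-trans l h))

opaque
  unfolding _·_

  ⊕-cong[] : ∀ {a a′ b b′ K} → a ≈[ K ] a′ → b ≈[ K ] b′ → a ⊕ b ≈[ K ] a′ ⊕ b′
  ⊕-cong[] p q = mk[] (λ n l → cong₂ _+ℤ_ (at[] p n l) (at[] q n l))

  ⊖-cong[] : ∀ {a a′ K} → a ≈[ K ] a′ → ⊖ a ≈[ K ] ⊖ a′
  ⊖-cong[] p = mk[] (λ n l → cong -ℤ_ (at[] p n l))

  ·-cong[] : ∀ {a a′ b b′ K} → a ≈[ K ] a′ → b ≈[ K ] b′ → a · b ≈[ K ] a′ · b′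
  ·-cong[] p q = mk[] (λ n l → ·-cong-≤ n (λ i h → at[] p i (ℕₚ.≤-<-trans h l)) (λ i h → at[] q i (ℕₚ.≤-<-trans h l)))

[]-setoid : ℕ → Setoid 0ℓ 0ℓ
[]-setoid K = record { Carrier = Series ; _≈_ = λ a b → a ≈[ K ] b
  ; isEquivalence = record { refl = []-refl ; sym = []-sym ; trans = []-trans } }

·-congˡ : ∀ {a b} c → a ≈ b → c · a ≈ c · b
·-congˡ c p = ·-cong {x = c} ≈-refl p

·-congʳ : ∀ {a b} c → a ≈ b → a · c ≈ b · c
·-congʳ c p = ·-cong {u = c} p ≈-refl

⊕-congˡ : ∀ {a b} c → a ≈ b → c ⊕ a ≈ c ⊕ b
⊕-congˡ c p = ⊕-cong {x = c} ≈-refl p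

⊕-congʳ : ∀ {a b} c → a ≈ b → a ⊕ c ≈ b ⊕ c
⊕-congʳ c p = ⊕-cong {u = c} p ≈-refl

sumTo-zero : ∀ n (f : ℕ → ℤ) → (∀ i → i < n → f i ≡ + 0) → sumTo n f ≡ + 0
sumTo-zero zero    f h = refl
sumTo-zero (suc n) f h = cong₂ _+ℤ_ (sumTo-zero n f (λ i p → h i (ℕₚ.m<n⇒m<1+n p))) (h n (ℕₚ.n<1+n n))

opaque
  unfolding _·_

  ·-order : ∀ {a b} K L → a ≈[ K ] zeroS → b ≈[ L ] zeroS → a · b ≈[ K + L ] zeroS
  ·-order {a} {b} K L p q = mk[] λ n n< → sumTo-zero (suc n) _ λ i i≤n → term n i n< (ℕₚ.≤-pred i≤n)
    where
    term : ∀ n i → n < K + L → i ≤ n → a i *ℤ b (n ∸ i) ≡ + 0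
    term n i n< i≤n with i ℕₚ.<? K
    ... | yes i<K = cong (_*ℤ b (n ∸ i)) (at[] p i i<K)
    ... | no  i≮K = trans (cong (a i *ℤ_) (at[] q (n ∸ i) n∸i<L)) (ℤₚ.*-zeroʳ (a i))
      where
      n∸i<L : n ∸ i < L
      n∸i<L = ℕₚ.+-cancelˡ-< K _ _ (ℕₚ.≤-<-trans (ℕₚ.+-monoˡ-≤ (n ∸ i) (ℕₚ.≮⇒≥ i≮K))
        (subst (_< K + L) (sym (ℕₚ.m+[n∸m]≡n i≤n)) n<))

-- Powers of the indeterminate and the factors 1 - q^e

X : Series
X zero    = + 0
X (suc n) = oneS n

opaque
  unfolding _·_

  X-·-suc : ∀ a n → (X · a) (suc n) ≡ a n
  X-·-suc a n = trans (·-suc X a n) (trans (ℤₚ.+-identityˡ _) (·-identityˡ-at a n))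

  X-·-zero : ∀ a → (X · a) 0 ≡ + 0
  X-·-zero a = ·-zero X a

infix 9 _↑_
_↑_ : Series → ℕ → Series
a ↑ zero  = oneS
a ↑ suc n = a ↑ n · a

↑-cong : ∀ {a b} n → a ≈ b → a ↑ n ≈ b ↑ n
↑-cong zero    p = ≈-refl
↑-cong (suc n) p = ·-cong (↑-cong n p) p

↑-+ : ∀ a m n → a ↑ (m + n) ≈ a ↑ m · a ↑ n
↑-+ a zero    n = ≈-sym (·-identityˡ _)
↑-+ a (suc m) n = begin
  a ↑ (m + n) · a          ≈⟨ ·-congʳ a (↑-+ a m n) ⟩
  a ↑ m · a ↑ n · a        ≈⟨ identity 3 (λ x y z → x :* y :* z := x :* z :* y) refl _ _ _ ⟩
  a ↑ m · a · a ↑ n        ∎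
  where open ≈-Reasoning

↑-* : ∀ a m n → a ↑ (m * n) ≈ (a ↑ n) ↑ m
↑-* a zero    n = ≈-refl
↑-* a (suc m) n = begin
  a ↑ (n + m * n)         ≈⟨ ↑-+ a n (m * n) ⟩
  a ↑ n · a ↑ (m * n)     ≈⟨ ·-congˡ _ (↑-* a m n) ⟩
  a ↑ n · (a ↑ n) ↑ m     ≈⟨ ·-comm _ _ ⟩
  (a ↑ n) ↑ m · a ↑ n     ∎
  where open ≈-Reasoning

·-↑ : ∀ a b n → (a · b) ↑ n ≈ a ↑ n · b ↑ n
·-↑ a b zero    = ≈-sym (·-identityˡ _)
·-↑ a b (suc n) = ≈-trans (·-congʳ (a · b) (·-↑ a b n))
  (identity 4 (λ x y a b → x :* y :* (a :* b) := x :* a :* (y :* b)) refl _ _ a b)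

↑-order : ∀ {Q} n → Q ≈[ 1 ] zeroS → Q ↑ n ≈[ n ] zeroS
↑-order zero    p = mk[] λ _ ()
↑-order {Q} (suc n) p = subst (λ K → Q ↑ suc n ≈[ K ] zeroS) (ℕₚ.+-comm n 1) (·-order n 1 (↑-order n p) p)

X↑-diag : ∀ n → (X ↑ n) n ≡ + 1
X↑-off  : ∀ m n → ¬ (n ≡ m) → (X ↑ m) n ≡ + 0
X↑-suc  : ∀ m n → (X ↑ suc m) (suc n) ≡ (X ↑ m) n
X↑-suc m n = trans (·-comm-at (suc n) (X ↑ m) X) (X-·-suc (X ↑ m) n)
X↑-diag zero    = refl
X↑-diag (suc n) = trans (X↑-suc n n) (X↑-diag n)
X↑-off zero    zero    h = contradiction refl h
X↑-off zero    (suc n) h = refl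
X↑-off (suc m) zero    h = trans (·-comm-at 0 (X ↑ m) X) (X-·-zero (X ↑ m))
X↑-off (suc m) (suc n) h = trans (X↑-suc m n) (X↑-off m n (h ∘ cong suc))

oneMinus : Series → Series
oneMinus a = oneS ⊕ ⊖ a

oneMinus-cong : ∀ {a b} → a ≈ b → oneMinus a ≈ oneMinus b
oneMinus-cong p = ⊕-congˡ oneS (⊖-cong p)

opaque
  unfolding _·_

  oneMinusQ≈ : ∀ e → oneMinusQ (suc e) ≈ oneMinus (X ↑ suc e)
  oneMinusQ≈ e = mk≈ go
    where
    go : ∀ n → oneMinusQ (suc e) n ≡ oneMinus (X ↑ suc e) n
    go n with n Data.Nat.≟ 0 | n Data.Nat.≟ suc e
    ... | yes refl | no  _    = cong (λ x → + 1 +ℤ -ℤ x) (sym (X↑-off (suc e) 0 λ ()))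
    ... | no  _    | yes refl = cong (λ x → + 0 +ℤ -ℤ x) (sym (X↑-diag (suc e)))
    ... | no  n≢0  | no  n≢e  with n
    ...   | zero  = contradiction refl n≢0
    ...   | suc k = cong (λ x → + 0 +ℤ -ℤ x) (sym (X↑-off (suc e) (suc k) n≢e))

-- Invertible series and cancellation

Inv : Series → Set
Inv a = Σ Series λ h → a · h ≈ oneS

·-cancelʳ : ∀ {a b} e → Inv e → a · e ≈ b · e → a ≈ b
·-cancelʳ {a} {b} e (h , eh) p = begin
  a              ≈⟨ ·-identityʳ a ⟨
  a · oneS       ≈⟨ ·-congˡ a eh ⟨
  a · (e · h)    ≈⟨ ·-assoc a e h ⟨
  a · e · h      ≈⟨ ·-congʳ h p ⟩
  b · e · h      ≈⟨ ·-assoc b e h ⟩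
  b · (e · h)    ≈⟨ ·-congˡ b eh ⟩
  b · oneS       ≈⟨ ·-identityʳ b ⟩
  b              ∎
  where open ≈-Reasoning

·-Inv : ∀ {a b} → Inv a → Inv b → Inv (a · b)
·-Inv {a} {b} (h , p) (k , q) = h · k , ≈-trans
  (identity 4 (λ a b h k → a :* b :* (h :* k) := a :* h :* (b :* k)) refl a b h k)
  (≈-trans (·-cong p q) (·-identityˡ oneS))

opaque
  unfolding _·_

  -- `invList c n` runs from the coefficient of index n down to that of index 0, so pairing it with
  -- ascending coefficients of a is a convolution; the offset k becomes a shift of a.
  dot≡· : ∀ c n a k → dot a k (invList c n) ≡ ((λ i → a (k + i)) · inv c) n
  dot≡· c zero a k = begin
    a k *ℤ + 1 +ℤ + 0                       ≡⟨ ℤₚ.+-identityʳ _ ⟩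
    a k *ℤ + 1                              ≡⟨ cong (λ j → a j *ℤ + 1) (ℕₚ.+-identityʳ k) ⟨
    a (k + 0) *ℤ + 1                       ≡⟨ ·-zero (λ i → a (k + i)) (inv c) ⟨
    ((λ i → a (k + i)) · inv c) 0          ∎
    where open ≡-Reasoning
  dot≡· c (suc n) a k = begin
    a k *ℤ inv c (suc n) +ℤ dot a (suc k) (invList c n)
      ≡⟨ cong₂ _+ℤ_ (cong (λ j → a j *ℤ inv c (suc n)) (sym (ℕₚ.+-identityʳ k))) (dot≡· c n a (suc k)) ⟩
    a (k + 0) *ℤ inv c (suc n) +ℤ ((λ i → a (suc k + i)) · inv c) n
      ≡⟨ cong (a (k + 0) *ℤ inv c (suc n) +ℤ_) (·-cong-≤ {b = inv c} n (λ i _ → cong a (sym (ℕₚ.+-suc k i))) (λ _ _ → refl)) ⟩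
    a (k + 0) *ℤ inv c (suc n) +ℤ (tail (λ i → a (k + i)) · inv c) n
      ≡⟨ ·-suc (λ i → a (k + i)) (inv c) n ⟨
    ((λ i → a (k + i)) · inv c) (suc n) ∎
    where open ≡-Reasoning

  inv-inverse : ∀ c → c 0 ≡ + 1 → c · inv c ≈ oneS
  inv-inverse c c0 = mk≈ go
    where
    open ≡-Reasoning
    go : ∀ n → (c · inv c) n ≡ oneS n
    go zero    = trans (·-zero c (inv c)) (cong (_*ℤ + 1) c0)
    go (suc n) = begin
      (c · inv c) (suc n)                                       ≡⟨ ·-suc c (inv c) n ⟩
      c 0 *ℤ -ℤ dot c 1 (invList c n) +ℤ (tail c · inv c) n     ≡⟨ cong₂ (λ x y → x *ℤ -ℤ y +ℤ (tail c · inv c) n) c0 (dot≡· c n c 1) ⟩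
      + 1 *ℤ -ℤ (tail c · inv c) n +ℤ (tail c · inv c) n        ≡⟨ cong (_+ℤ (tail c · inv c) n) (ℤₚ.*-identityˡ (-ℤ (tail c · inv c) n)) ⟩
      -ℤ (tail c · inv c) n +ℤ (tail c · inv c) n               ≡⟨ ℤₚ.+-inverseˡ ((tail c · inv c) n) ⟩
      + 0                                                       ∎

Inv-unit : ∀ c → c 0 ≡ + 1 → Inv c
Inv-unit c c0 = inv c , inv-inverse c c0

-- Infinite products (x; Q)_∞ of series

prod : Series → Series → ℕ → Series
prod x Q zero    = oneS
prod x Q (suc n) = prod x Q n · oneMinus (x · Q ↑ n)

prod∞ : Series → Series → Series
prod∞ x Q n = prod x Q (suc n) n

oneMinus-≈[] : ∀ {a} K → a ≈[ K ] zeroS → oneMinus a ≈[ K ] oneS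
oneMinus-≈[] K p = []-trans (⊕-cong[] []-refl (⊖-cong[] p)) (≈⇒[] (identity 0 (con (+ 1) :- con (+ 0) := con (+ 1)) refl))

-- The factor of index i differs from 1 by x Q^i, which is divisible by q^i even when x is a unit.
-- The products with x = -1 in the theta functions depend on this.
prod-stable : ∀ x Q {K N} → Q ≈[ 1 ] zeroS → K ≤ N → prod x Q K ≈[ K ] prod x Q N
prod-stable x Q {K} {N} Q0 K≤N = subst (λ M → prod x Q K ≈[ K ] prod x Q M) (trans (ℕₚ.+-comm (N ∸ K) K) (ℕₚ.m+[n∸m]≡n K≤N)) (go (N ∸ K))
  where
  go : ∀ d → prod x Q K ≈[ K ] prod x Q (d + K)
  go zero    = []-refl
  go (suc d) = []-trans (go d) ([]-trans (≈⇒[] (≈-sym (·-identityʳ (prod x Q (d + K)))))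
    (·-cong[] []-refl ([]-sym (oneMinus-≈[] K ([]-weaken (ℕₚ.m≤n+m K d) (·-order {x} 0 (d + K) (mk[] λ _ ()) (↑-order (d + K) Q0)))))))

prod∞-approx : ∀ x Q {K N} → Q ≈[ 1 ] zeroS → K ≤ N → prod∞ x Q ≈[ K ] prod x Q N
prod∞-approx x Q Q0 K≤N = mk[] λ n n<K → at[] (prod-stable x Q Q0 (ℕₚ.≤-trans n<K K≤N)) n (ℕₚ.n<1+n n)

prod-cong : ∀ {x x′ Q Q′} n → x ≈ x′ → Q ≈ Q′ → prod x Q n ≈ prod x′ Q′ n
prod-cong zero    p q = ≈-refl
prod-cong (suc n) p q = ·-cong (prod-cong n p q) (oneMinus-cong (·-cong p (↑-cong n q)))

prod∞-cong : ∀ {x x′ Q Q′} → x ≈ x′ → Q ≈ Q′ → prod∞ x Q ≈ prod∞ x′ Q′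
prod∞-cong p q = mk≈ λ n → at (prod-cong (suc n) p q) n

oneMinus-zero : ∀ a → a 0 ≡ + 0 → oneMinus a 0 ≡ + 1
oneMinus-zero a p = trans (⊕-at oneS (⊖ a) 0) (cong (+ 1 +ℤ_) (trans (⊖-at a 0) (cong -ℤ_ p)))

prod-zero : ∀ x Q n → x 0 ≡ + 0 → prod x Q n 0 ≡ + 1
prod-zero x Q zero    p = refl
prod-zero x Q (suc n) p = trans (·-zero (prod x Q n) (oneMinus (x · Q ↑ n))) (cong₂ _*ℤ_ (prod-zero x Q n p)
  (oneMinus-zero (x · Q ↑ n) (trans (·-zero x (Q ↑ n)) (cong (_*ℤ (Q ↑ n) 0) p))))

prod∞-Inv : ∀ x Q → x 0 ≡ + 0 → Inv (prod∞ x Q)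
prod∞-Inv x Q p = Inv-unit _ (prod-zero x Q 1 p)

opaque
  unfolding _·_

  finPoch≈prod : ∀ a d n → finPoch (suc a) d n ≈ prod (X ↑ suc a) (X ↑ d) n
  finPoch≈prod a d zero    = ≈-refl
  finPoch≈prod a d (suc n) = ·-cong (finPoch≈prod a d n) (≈-trans (oneMinusQ≈ (a + n * d))
    (oneMinus-cong (≈-trans (↑-+ X (suc a) (n * d)) (·-congˡ (X ↑ suc a) (↑-* X n d)))))

poch≈prod∞ : ∀ a d → poch (suc a) d ≈ prod∞ (X ↑ suc a) (X ↑ d)
poch≈prod∞ a d = mk≈ λ n → at (finPoch≈prod a d (suc n)) n

-- The substitution of q³ for q

T : Series → Series
T a 0                   = a 0
T a 1                   = + 0
T a 2                   = + 0
T a (suc (suc (suc n))) = T (tail a) n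

T-at : ∀ {a b} n → (∀ i → i ≤ n → a i ≡ b i) → T a n ≡ T b n
T-at 0 h = h 0 z≤n
T-at 1 h = refl
T-at 2 h = refl
T-at (suc (suc (suc n))) h = T-at n (λ i i≤n → h (suc i) (s≤s (ℕₚ.≤-trans i≤n (ℕₚ.m≤n+m n 2))))

T-cong : ∀ {a b} → a ≈ b → T a ≈ T b
T-cong p = mk≈ λ n → T-at n (λ i _ → at p i)

T-cong[] : ∀ {a b K} → a ≈[ K ] b → T a ≈[ K ] T b
T-cong[] p = mk[] λ n l → T-at n (λ i h → at[] p i (ℕₚ.≤-<-trans h l))

opaque
  unfolding _·_

  T-⊕-at : ∀ a b n → T (a ⊕ b) n ≡ T a n +ℤ T b n
  T-⊕-at a b 0 = refl
  T-⊕-at a b 1 = refl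
  T-⊕-at a b 2 = refl
  T-⊕-at a b (suc (suc (suc n))) = T-⊕-at (tail a) (tail b) n

  T-⊕ : ∀ a b → T (a ⊕ b) ≈ T a ⊕ T b
  T-⊕ a b = mk≈ (T-⊕-at a b)

  T-⊖ : ∀ a → T (⊖ a) ≈ ⊖ T a
  T-⊖ a = mk≈ (go a)
    where
    go : ∀ a n → T (⊖ a) n ≡ -ℤ T a n
    go a 0 = refl
    go a 1 = refl
    go a 2 = refl
    go a (suc (suc (suc n))) = go (tail a) n

  T-scale-at : ∀ c a n → T (constS c · a) n ≡ c *ℤ T a n
  T-scale-at c a 0 = constS-· c a 0
  T-scale-at c a 1 = sym (ℤₚ.*-zeroʳ c)
  T-scale-at c a 2 = sym (ℤₚ.*-zeroʳ c)
  T-scale-at c a (suc (suc (suc n))) = trans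
    (T-at n (λ i _ → trans (constS-· c a (suc i)) (sym (constS-· c (tail a) i)))) (T-scale-at c (tail a) n)

  -- Induction in steps of three. The coefficients of `T a` at 1 and 2 vanish, so after the first
  -- term two further peelings cost nothing and reach `T (tail a)`.
  T-·-at : ∀ n a b → T (a · b) n ≡ (T a · T b) n
  T-·-at 0 a b = trans (·-zero a b) (sym (·-zero (T a) (T b)))
  T-·-at 1 a b = begin
    + 0                                        ≡⟨ cong₂ _+ℤ_ (ℤₚ.*-zeroʳ (a 0)) (·-zero (tail (T a)) (T b)) ⟨
    a 0 *ℤ + 0 +ℤ (tail (T a) · T b) 0         ≡⟨ ·-suc (T a) (T b) 0 ⟨
    (T a · T b) 1                              ∎
    where open ≡-Reasoning
  T-·-at 2 a b = begin
    + 0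
      ≡⟨ cong₂ _+ℤ_ (ℤₚ.*-zeroʳ (a 0)) (trans (·-suc (tail (T a)) (T b) 0) (cong (+ 0 +ℤ_) (·-zero (tail (tail (T a))) (T b)))) ⟨
    a 0 *ℤ + 0 +ℤ (tail (T a) · T b) 1
      ≡⟨ ·-suc (T a) (T b) 1 ⟨
    (T a · T b) 2 ∎
    where open ≡-Reasoning
  T-·-at (suc (suc (suc n))) a b = begin
    T (tail (a · b)) n
      ≡⟨ T-at n (λ i _ → tail-· a b i) ⟩
    T ((constS (a 0) · tail b) ⊕ (tail a · b)) n
      ≡⟨ T-⊕-at (constS (a 0) · tail b) (tail a · b) n ⟩
    T (constS (a 0) · tail b) n +ℤ T (tail a · b) n
      ≡⟨ cong₂ _+ℤ_ (T-scale-at (a 0) (tail b) n) (T-·-at n (tail a) b) ⟩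
    a 0 *ℤ T (tail b) n +ℤ (T (tail a) · T b) n
      ≡⟨ cong (a 0 *ℤ T (tail b) n +ℤ_) (trans (drop-zero (tail (T a)) refl (suc n)) (drop-zero (tail (tail (T a))) refl n)) ⟨
    a 0 *ℤ T b (suc (suc (suc n))) +ℤ (tail (T a) · T b) (suc (suc n))
      ≡⟨ ·-suc (T a) (T b) (suc (suc n)) ⟨
    (T a · T b) (suc (suc (suc n))) ∎
    where
    open ≡-Reasoning
    drop-zero : ∀ c → c 0 ≡ + 0 → ∀ m → (c · T b) (suc m) ≡ (tail c · T b) m
    drop-zero c c0 m = trans (·-suc c (T b) m) (trans (cong (λ z → z *ℤ T b (suc m) +ℤ (tail c · T b) m) c0) (ℤₚ.+-identityˡ ((tail c · T b) m)))

T-· : ∀ a b → T (a · b) ≈ T a · T b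
T-· a b = mk≈ λ n → T-·-at n a b

T-constS : ∀ c → T (constS c) ≈ constS c
T-constS c = mk≈ go
  where
  zeros : ∀ n → T zeroS n ≡ + 0
  zeros 0 = refl
  zeros 1 = refl
  zeros 2 = refl
  zeros (suc (suc (suc n))) = zeros n
  go : ∀ n → T (constS c) n ≡ constS c n
  go 0 = refl
  go 1 = refl
  go 2 = refl
  go (suc (suc (suc n))) = zeros n

T-one : T oneS ≈ oneS
T-one = ≈-trans (T-cong (embed≈constS (+ 1))) (≈-trans (T-constS (+ 1)) (≈-sym (embed≈constS (+ 1))))

T-X : T X ≈ X ↑ 3
T-X = mk≈ go
  where
  go : ∀ n → T X n ≡ (X ↑ 3) n
  go 0 = sym (X↑-off 3 0 λ ())
  go 1 = sym (X↑-off 3 1 λ ())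
  go 2 = sym (X↑-off 3 2 λ ())
  go (suc (suc (suc n))) = trans (at T-one n) (sym (trans (X↑-suc 2 (suc (suc n))) (trans (X↑-suc 1 (suc n)) (X↑-suc 0 n))))

T-↑ : ∀ a n → T (a ↑ n) ≈ T a ↑ n
T-↑ a zero    = T-one
T-↑ a (suc n) = ≈-trans (T-· (a ↑ n) a) (·-congʳ (T a) (T-↑ a n))

T-oneMinus : ∀ a → T (oneMinus a) ≈ oneMinus (T a)
T-oneMinus a = ≈-trans (T-⊕ oneS (⊖ a)) (⊕-cong T-one (T-⊖ a))

T-prod : ∀ x Q n → T (prod x Q n) ≈ prod (T x) (T Q) n
T-prod x Q zero    = T-one
T-prod x Q (suc n) = ≈-trans (T-· (prod x Q n) (oneMinus (x · Q ↑ n)))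
  (·-cong (T-prod x Q n) (≈-trans (T-oneMinus (x · Q ↑ n)) (oneMinus-cong (≈-trans (T-· x (Q ↑ n)) (·-congˡ (T x) (T-↑ Q n))))))

T-order : ∀ {Q} → Q ≈[ 1 ] zeroS → T Q ≈[ 1 ] zeroS
T-order p = mk[] λ { zero l → at[] p 0 l ; (suc n) (s≤s ()) }

T-prod∞ : ∀ x Q → Q ≈[ 1 ] zeroS → T (prod∞ x Q) ≈ prod∞ (T x) (T Q)
T-prod∞ x Q Q0 = []⇒≈ λ K → []-trans (T-cong[] (prod∞-approx x Q Q0 (ℕₚ.≤-refl {K})))
  ([]-trans (≈⇒[] (T-prod x Q K)) ([]-sym (prod∞-approx (T x) (T Q) (T-order Q0) ℕₚ.≤-refl)))

-- Residue classes of exponents modulo 3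

U : ℕ → Series → Series
U i a n = a (i + n * 3)

interleave : Series → Series → Series → Series
interleave a b c 0 = a 0
interleave a b c 1 = b 0
interleave a b c 2 = c 0
interleave a b c (suc (suc (suc n))) = interleave (tail a) (tail b) (tail c) n

interleave-U : ∀ f → interleave (U 0 f) (U 1 f) (U 2 f) ≈ f
interleave-U f = mk≈ (go f)
  where
  go : ∀ f n → interleave (U 0 f) (U 1 f) (U 2 f) n ≡ f n
  go f 0 = refl
  go f 1 = refl
  go f 2 = refl
  go f (suc (suc (suc n))) = go (tail (tail (tail f))) n

U-interleave₀ : ∀ a b c → U 0 (interleave a b c) ≈ a
U-interleave₀ a b c = mk≈ (go a b c)
  where
  go : ∀ a b c n → U 0 (interleave a b c) n ≡ a n
  go a b c zero    = refl
  go a b c (suc n) = go (tail a) (tail b) (tail c) n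

U-interleave₁ : ∀ a b c → U 1 (interleave a b c) ≈ b
U-interleave₁ a b c = mk≈ (go a b c)
  where
  go : ∀ a b c n → U 1 (interleave a b c) n ≡ b n
  go a b c zero    = refl
  go a b c (suc n) = go (tail a) (tail b) (tail c) n

U-interleave₂ : ∀ a b c → U 2 (interleave a b c) ≈ c
U-interleave₂ a b c = mk≈ (go a b c)
  where
  go : ∀ a b c n → U 2 (interleave a b c) n ≡ c n
  go a b c zero    = refl
  go a b c (suc n) = go (tail a) (tail b) (tail c) n

U-cong : ∀ {f g} i → f ≈ g → U i f ≈ U i g
U-cong i p = mk≈ λ n → at p (i + n * 3)

U-cong[] : ∀ {f g K} i → i < 3 → f ≈[ K * 3 ] g → U i f ≈[ K ] U i g
U-cong[] {K = K} i i<3 p = mk[] λ n n<K → at[] p (i + n * 3) (ℕₚ.<-≤-trans (ℕₚ.+-monoˡ-< (n * 3) i<3) (ℕₚ.*-monoˡ-≤ 3 n<K))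

dissected : Series → Series → Series → Series
dissected a b c = T a ⊕ X · T b ⊕ X · X · T c

-- Existence and uniqueness of the dissection both rest on this: `interleave` yields its parts by
-- recursion, while `dissected` is the form on which ring identities operate.
interleave≈dissected : ∀ a b c → interleave a b c ≈ dissected a b c
interleave≈dissected a b c = mk≈ λ n → trans (go a b c n) (sym (rhs n))
  where
  shift : Series → Series
  shift a zero    = + 0
  shift a (suc n) = a n
  X-· : ∀ a n → (X · a) n ≡ shift a n
  X-· a zero    = X-·-zero a
  X-· a (suc n) = X-·-suc a n
  shift-cong : ∀ {a b} → (∀ n → a n ≡ b n) → ∀ n → shift a n ≡ shift b n
  shift-cong h zero    = refl
  shift-cong h (suc n) = h n
  rhs : ∀ n → dissected a b c n ≡ T a n +ℤ shift (T b) n +ℤ shift (shift (T c)) n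
  rhs n = trans (⊕-at (T a ⊕ X · T b) (X · X · T c) n) (cong₂ _+ℤ_
    (trans (⊕-at (T a) (X · T b) n) (cong (T a n +ℤ_) (X-· (T b) n)))
    (trans (at (·-assoc X X (T c)) n) (trans (X-· (X · T c) n) (shift-cong (X-· (T c)) n))))
  go : ∀ a b c n → interleave a b c n ≡ T a n +ℤ shift (T b) n +ℤ shift (shift (T c)) n
  go a b c 0 = sym (trans (ℤₚ.+-identityʳ (a 0 +ℤ + 0)) (ℤₚ.+-identityʳ (a 0)))
  go a b c 1 = sym (trans (ℤₚ.+-identityʳ (+ 0 +ℤ b 0)) (ℤₚ.+-identityˡ (b 0)))
  go a b c 2 = sym (ℤₚ.+-identityˡ (c 0))
  go a b c 3 = go (tail a) (tail b) (tail c) 0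
  go a b c 4 = go (tail a) (tail b) (tail c) 1
  go a b c (suc (suc (suc (suc (suc n))))) = go (tail a) (tail b) (tail c) (suc (suc n))

dissect : ∀ f → f ≈ dissected (U 0 f) (U 1 f) (U 2 f)
dissect f = ≈-trans (≈-sym (interleave-U f)) (interleave≈dissected (U 0 f) (U 1 f) (U 2 f))

U-dissected₀ : ∀ {f a b c} → f ≈ dissected a b c → U 0 f ≈ a
U-dissected₀ {f} {a} {b} {c} p = ≈-trans (U-cong 0 (≈-trans p (≈-sym (interleave≈dissected a b c)))) (U-interleave₀ a b c)

U-dissected₁ : ∀ {f a b c} → f ≈ dissected a b c → U 1 f ≈ b
U-dissected₁ {f} {a} {b} {c} p = ≈-trans (U-cong 1 (≈-trans p (≈-sym (interleave≈dissected a b c)))) (U-interleave₁ a b c)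

U-dissected₂ : ∀ {f a b c} → f ≈ dissected a b c → U 2 f ≈ c
U-dissected₂ {f} {a} {b} {c} p = ≈-trans (U-cong 2 (≈-trans p (≈-sym (interleave≈dissected a b c)))) (U-interleave₂ a b c)

open import Algebra.Properties.Semiring.Exp SR.semiring using (_^_)

T-embed : ∀ c → T (embed c) ≈ embed c
T-embed c = ≈-trans (T-cong (embed≈constS c)) (≈-trans (T-constS c) (≈-sym (embed≈constS c)))

-- As a ring endomorphism fixing constants, `T` passes to the variables of any polynomial
-- expression. Two environments are needed because `X` itself is sent to its cube.
T-polynomial : ∀ {n} (p : Polynomial n) {ρ σ : Vec Series n} → Pointwise (λ a b → T a ≈ b) ρ σ → T (RS.⟦ p ⟧ ρ) ≈ RS.⟦ p ⟧ σ
T-polynomial (RS.op RS.[+] p q) h = ≈-trans (T-⊕ _ _) (⊕-cong (T-polynomial p h) (T-polynomial q h))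
T-polynomial (RS.op RS.[*] p q) h = ≈-trans (T-· _ _) (·-cong (T-polynomial p h) (T-polynomial q h))
T-polynomial (con c)            h = T-embed c
T-polynomial (RS.var i)         h = Pointwise.lookup h i
T-polynomial (p RS.:^ n)        h = power n
  where
  power : ∀ n → T (RS.⟦ p ⟧ _ ^ n) ≈ RS.⟦ p ⟧ _ ^ n
  power zero    = T-one
  power (suc n) = ≈-trans (T-· _ _) (·-cong (T-polynomial p h) (power n))
T-polynomial (:- p)             h = ≈-trans (T-⊖ _) (⊖-cong (T-polynomial p h))

-- The cubic norm of a 3-dissection

cubicNorm : Series → Series → Series → Series
cubicNorm a b c = a · a · a ⊕ X · (b · b · b) ⊕ X · X · (c · c · c) ⊕ ⊖ (constS (+ 3) · X · a · b · c)

cubicNormₚ : ∀ {n} (x a b c : Polynomial n) → Polynomial n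
cubicNormₚ x a b c = a :* a :* a :+ x :* (b :* b :* b) :+ x :* x :* (c :* c :* c) :- con (+ 3) :* x :* a :* b :* c

norm : Series → Series
norm f = cubicNorm (U 0 f) (U 1 f) (U 2 f)

cubicNorm-cong : ∀ {a a′ b b′ c c′} → a ≈ a′ → b ≈ b′ → c ≈ c′ → cubicNorm a b c ≈ cubicNorm a′ b′ c′
cubicNorm-cong p q r = ⊕-cong (⊕-cong (⊕-cong (·-cong (·-cong p p) p) (·-congˡ X (·-cong (·-cong q q) q)))
  (·-congˡ (X · X) (·-cong (·-cong r r) r))) (⊖-cong (·-cong (·-cong (·-congˡ (constS (+ 3) · X) p) q) r))

cubicNorm-cong[] : ∀ {a a′ b b′ c c′ K} → a ≈[ K ] a′ → b ≈[ K ] b′ → c ≈[ K ] c′ → cubicNorm a b c ≈[ K ] cubicNorm a′ b′ c′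
cubicNorm-cong[] p q r = ⊕-cong[] (⊕-cong[] (⊕-cong[] (·-cong[] (·-cong[] p p) p) (·-cong[] []-refl (·-cong[] (·-cong[] q q) q)))
  (·-cong[] []-refl (·-cong[] (·-cong[] r r) r))) (⊖-cong[] (·-cong[] (·-cong[] (·-cong[] []-refl p) q) r))

norm-cong : ∀ {f g} → f ≈ g → norm f ≈ norm g
norm-cong p = cubicNorm-cong (U-cong 0 p) (U-cong 1 p) (U-cong 2 p)

-- The precision drops by a factor of 3, since the coefficients of the parts below q^K are those of
-- f below q^(3K).
norm-cong[] : ∀ {f g K} → f ≈[ K * 3 ] g → norm f ≈[ K ] norm g
norm-cong[] p = cubicNorm-cong[] (U-cong[] 0 (s≤s z≤n) p) (U-cong[] 1 (s≤s (s≤s z≤n)) p) (U-cong[] 2 ℕₚ.≤-refl p)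

norm-dissected : ∀ {f a b c} → f ≈ dissected a b c → norm f ≈ cubicNorm a b c
norm-dissected p = cubicNorm-cong (U-dissected₀ p) (U-dissected₁ p) (U-dissected₂ p)

T-·-dissected : ∀ g a b c → T g · dissected a b c ≈ dissected (g · a) (g · b) (g · c)
T-·-dissected g a b c = ≈-trans
  (identity 5 (λ x g a b c → g :* (a :+ x :* b :+ x :* x :* c) := g :* a :+ x :* (g :* b) :+ x :* x :* (g :* c)) refl X (T g) (T a) (T b) (T c))
  (≈-sym (⊕-cong (⊕-cong (T-· g a) (·-congˡ X (T-· g b))) (·-congˡ (X · X) (T-· g c))))

U₂-T : ∀ g f → U 2 (T g · f) ≈ g · U 2 f
U₂-T g f = U-dissected₂ (≈-trans (·-congˡ (T g) (dissect f)) (T-·-dissected g (U 0 f) (U 1 f) (U 2 f)))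

X³≈T : T X ≈ X · X · X
X³≈T = ≈-trans T-X (identity 1 (λ x → con (+ 1) :* x :* x :* x := x :* x :* x) refl X)

-- The second factor is f(ωq) f(ω²q), sorted by residue classes. Once `T` has been moved to the
-- variables, an identity of polynomials in q, with q³ for the inner variable, remains.
dissected-conjugate : ∀ a b c →
  dissected a b c · dissected (a · a ⊕ ⊖ (X · b · c)) (X · c · c ⊕ ⊖ (a · b)) (b · b ⊕ ⊖ (a · c)) ≈ T (cubicNorm a b c)
dissected-conjugate a b c = begin
  dissected a b c · dissected (a · a ⊕ ⊖ (X · b · c)) (X · c · c ⊕ ⊖ (a · b)) (b · b ⊕ ⊖ (a · c))
    ≈⟨ ·-congˡ (dissected a b c) (⊕-cong (⊕-cong (T-polynomial p₀ h) (·-congˡ X (T-polynomial p₁ h))) (·-congˡ (X · X) (T-polynomial p₂ h))) ⟩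
  (T a ⊕ X · T b ⊕ X · X · T c) · (RS.⟦ p₀ ⟧ σ ⊕ X · RS.⟦ p₁ ⟧ σ ⊕ X · X · RS.⟦ p₂ ⟧ σ)
    ≈⟨ identity 4 (λ x a b c → let y = x :* x :* x in
         (a :+ x :* b :+ x :* x :* c) :* ((a :* a :- y :* b :* c) :+ x :* (y :* c :* c :- a :* b) :+ x :* x :* (b :* b :- a :* c))
         := cubicNormₚ y a b c) refl X (T a) (T b) (T c) ⟩
  RS.⟦ pₙ ⟧ σ
    ≈⟨ T-polynomial pₙ h ⟨
  T (cubicNorm a b c) ∎
  where
  open ≈-Reasoning
  σ : Vec Series 4
  σ = X · X · X ∷ T a ∷ T b ∷ T c ∷ []
  h : Pointwise (λ a b → T a ≈ b) (X ∷ a ∷ b ∷ c ∷ []) σ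
  h = X³≈T ∷ ≈-refl ∷ ≈-refl ∷ ≈-refl ∷ []
  p₀ p₁ p₂ pₙ : Polynomial 4
  p₀ = close 4 λ x a b c → a :* a :- x :* b :* c
  p₁ = close 4 λ x a b c → x :* c :* c :- a :* b
  p₂ = close 4 λ x a b c → b :* b :- a :* c
  pₙ = close 4 λ x a b c → cubicNormₚ x a b c

-- A series in q³ is a scalar for the dissection: it multiplies all three parts alike, and the norm
-- is cubic.
norm-oneMinus₀ : ∀ y f → norm (f · oneMinus (T y)) ≈ norm f · (oneMinus y · oneMinus y · oneMinus y)
norm-oneMinus₀ y f = ≈-trans (norm-dissected (begin
  f · oneMinus (T y)                                        ≈⟨ ·-comm f (oneMinus (T y)) ⟩
  oneMinus (T y) · f                                        ≈⟨ ·-cong (≈-sym (T-oneMinus y)) (dissect f) ⟩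
  T (oneMinus y) · dissected (U 0 f) (U 1 f) (U 2 f)        ≈⟨ T-·-dissected (oneMinus y) (U 0 f) (U 1 f) (U 2 f) ⟩
  dissected (oneMinus y · U 0 f) (oneMinus y · U 1 f) (oneMinus y · U 2 f) ∎))
  (identity 5 (λ x y a b c → cubicNormₚ x (y :* a) (y :* b) (y :* c) := cubicNormₚ x a b c :* (y :* y :* y)) refl
    X (oneMinus y) (U 0 f) (U 1 f) (U 2 f))
  where open ≈-Reasoning

-- Multiplication by q y(q³) moves each class to the next; the part that returns from class 2 to
-- class 0 gains q³, hence the single `X` in the new parts. The factor reflects (1 - z)(1 - ωz)(1 -
-- ω²z) = 1 - z³.
norm-oneMinus₁ : ∀ y f → norm (f · oneMinus (X · T y)) ≈ norm f · oneMinus (X · y · y · y)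
norm-oneMinus₁ y f = ≈-trans (norm-dissected (begin
  f · oneMinus (X · T y)
    ≈⟨ ·-congʳ (oneMinus (X · T y)) (dissect f) ⟩
  dissected a b c · oneMinus (X · T y)
    ≈⟨ identity 5 (λ x y a b c → (a :+ x :* b :+ x :* x :* c) :* (con (+ 1) :- x :* y)
         := (a :- x :* x :* x :* y :* c) :+ x :* (b :- y :* a) :+ x :* x :* (c :- y :* b)) refl X (T y) (T a) (T b) (T c) ⟩
  RS.⟦ p₀ ⟧ σ ⊕ X · RS.⟦ p₁ ⟧ σ ⊕ X · X · RS.⟦ p₂ ⟧ σ
    ≈⟨ ⊕-cong (⊕-cong (T-polynomial p₀ h) (·-congˡ X (T-polynomial p₁ h))) (·-congˡ (X · X) (T-polynomial p₂ h)) ⟨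
  dissected (a ⊕ ⊖ (X · y · c)) (b ⊕ ⊖ (y · a)) (c ⊕ ⊖ (y · b)) ∎))
  (identity 5 (λ x y a b c → cubicNormₚ x (a :- x :* y :* c) (b :- y :* a) (c :- y :* b)
    := cubicNormₚ x a b c :* (con (+ 1) :- x :* y :* y :* y)) refl X y a b c)
  where
  open ≈-Reasoning
  a = U 0 f ; b = U 1 f ; c = U 2 f
  σ : Vec Series 5
  σ = X · X · X ∷ T y ∷ T a ∷ T b ∷ T c ∷ []
  h : Pointwise (λ a b → T a ≈ b) (X ∷ y ∷ a ∷ b ∷ c ∷ []) σ
  h = X³≈T ∷ ≈-refl ∷ ≈-refl ∷ ≈-refl ∷ ≈-refl ∷ []
  p₀ p₁ p₂ : Polynomial 5
  p₀ = close 5 λ x y a b c → a :- x :* y :* c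
  p₁ = close 5 λ x y a b c → b :- y :* a
  p₂ = close 5 λ x y a b c → c :- y :* b

-- Now the shift is by two classes, so two of the three parts wrap around and gain q³.
norm-oneMinus₂ : ∀ y f → norm (f · oneMinus (X · X · T y)) ≈ norm f · oneMinus (X · X · y · y · y)
norm-oneMinus₂ y f = ≈-trans (norm-dissected (begin
  f · oneMinus (X · X · T y)
    ≈⟨ ·-congʳ (oneMinus (X · X · T y)) (dissect f) ⟩
  dissected a b c · oneMinus (X · X · T y)
    ≈⟨ identity 5 (λ x y a b c → (a :+ x :* b :+ x :* x :* c) :* (con (+ 1) :- x :* x :* y)
         := (a :- x :* x :* x :* y :* b) :+ x :* (b :- x :* x :* x :* y :* c) :+ x :* x :* (c :- y :* a)) refl X (T y) (T a) (T b) (T c) ⟩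
  RS.⟦ p₀ ⟧ σ ⊕ X · RS.⟦ p₁ ⟧ σ ⊕ X · X · RS.⟦ p₂ ⟧ σ
    ≈⟨ ⊕-cong (⊕-cong (T-polynomial p₀ h) (·-congˡ X (T-polynomial p₁ h))) (·-congˡ (X · X) (T-polynomial p₂ h)) ⟨
  dissected (a ⊕ ⊖ (X · y · b)) (b ⊕ ⊖ (X · y · c)) (c ⊕ ⊖ (y · a)) ∎))
  (identity 5 (λ x y a b c → cubicNormₚ x (a :- x :* y :* b) (b :- x :* y :* c) (c :- y :* a)
    := cubicNormₚ x a b c :* (con (+ 1) :- x :* x :* y :* y :* y)) refl X y a b c)
  where
  open ≈-Reasoning
  a = U 0 f ; b = U 1 f ; c = U 2 f
  σ : Vec Series 5
  σ = X · X · X ∷ T y ∷ T a ∷ T b ∷ T c ∷ []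
  h : Pointwise (λ a b → T a ≈ b) (X ∷ y ∷ a ∷ b ∷ c ∷ []) σ
  h = X³≈T ∷ ≈-refl ∷ ≈-refl ∷ ≈-refl ∷ ≈-refl ∷ []
  p₀ p₁ p₂ : Polynomial 5
  p₀ = close 5 λ x y a b c → a :- x :* y :* b
  p₁ = close 5 λ x y a b c → b :- x :* y :* c
  p₂ = close 5 λ x y a b c → c :- y :* a

-- The norm of Euler products

E : ℕ → Series
E d = prod∞ (X ↑ d) (X ↑ d)

X↑-order : ∀ d → X ↑ suc d ≈[ 1 ] zeroS
X↑-order d = []-weaken (s≤s z≤n) (↑-order (suc d) (mk[] λ { zero _ → refl ; (suc _) (s≤s ()) }))

E-Inv : ∀ d → Inv (E (suc d))
E-Inv d = prod∞-Inv (X ↑ suc d) (X ↑ suc d) (at[] (X↑-order d) 0 ℕₚ.≤-refl)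

T-X↑ : ∀ m → T (X ↑ m) ≈ X ↑ (m * 3)
T-X↑ m = ≈-trans (T-↑ X m) (≈-trans (↑-cong m T-X) (≈-sym (↑-* X m 3)))

T-cube : ∀ m → T (X ↑ m) ≈ X ↑ m · X ↑ m · X ↑ m
T-cube m = begin
  T (X ↑ m)                    ≈⟨ T-X↑ m ⟩
  X ↑ (m * 3)                 ≈⟨ SR.reflexive (cong (X ↑_) (ℕₚ.*-comm m 3)) ⟩
  X ↑ (3 * m)                 ≈⟨ ↑-* X 3 m ⟩
  oneS · X ↑ m · X ↑ m · X ↑ m ≈⟨ identity 1 (λ x → con (+ 1) :* x :* x :* x := x :* x :* x) refl (X ↑ m) ⟩
  X ↑ m · X ↑ m · X ↑ m        ∎
  where open ≈-Reasoning

-- The instances are 1 - q^e with 3 not dividing e: the conjugates multiply to 1 - q^(3e), which in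
-- terms of q³ is the same factor again. The arbitrary f allows the factors of a product to be
-- removed one at a time.
NormFixed : Series → Set
NormFixed u = ∀ f → norm (f · u) ≈ norm f · u

normFixed₁ : ∀ m → NormFixed (oneMinus (X ↑ (1 + m * 3)))
normFixed₁ m f = ≈-trans
  (norm-cong (·-congˡ f (oneMinus-cong (≈-trans (·-congʳ X (≈-sym (T-X↑ m))) (·-comm (T (X ↑ m)) X)))))
  (≈-trans (norm-oneMinus₁ (X ↑ m) f) (·-congˡ (norm f) (oneMinus-cong (begin
    X · X ↑ m · X ↑ m · X ↑ m      ≈⟨ identity 2 (λ x y → x :* y :* y :* y := y :* y :* y :* x) refl X (X ↑ m) ⟩
    X ↑ m · X ↑ m · X ↑ m · X      ≈⟨ ·-congʳ X (≈-trans (≈-sym (T-cube m)) (T-X↑ m)) ⟩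
    X ↑ (1 + m * 3)              ∎))))
  where open ≈-Reasoning

normFixed₂ : ∀ m → NormFixed (oneMinus (X ↑ (2 + m * 3)))
normFixed₂ m f = ≈-trans
  (norm-cong (·-congˡ f (oneMinus-cong (≈-trans (·-congʳ X (·-congʳ X (≈-sym (T-X↑ m))))
    (identity 2 (λ x y → y :* x :* x := x :* x :* y) refl X (T (X ↑ m)))))))
  (≈-trans (norm-oneMinus₂ (X ↑ m) f) (·-congˡ (norm f) (oneMinus-cong (begin
    X · X · X ↑ m · X ↑ m · X ↑ m      ≈⟨ identity 2 (λ x y → x :* x :* y :* y :* y := y :* y :* y :* x :* x) refl X (X ↑ m) ⟩
    X ↑ m · X ↑ m · X ↑ m · X · X      ≈⟨ ·-congʳ X (·-congʳ X (≈-trans (≈-sym (T-cube m)) (T-X↑ m))) ⟩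
    X ↑ (2 + m * 3)                  ∎))))
  where open ≈-Reasoning

normFixed-cong : ∀ {u v} → u ≈ v → NormFixed u → NormFixed v
normFixed-cong p h f = ≈-trans (norm-cong (·-congˡ f (≈-sym p))) (≈-trans (h f) (·-congˡ (norm f) p))

X↑-progression : ∀ d n → X ↑ d · (X ↑ d) ↑ n ≈ X ↑ (d + n * d)
X↑-progression d n = ≈-trans (·-congˡ (X ↑ d) (≈-sym (↑-* X n d))) (≈-sym (↑-+ X d (n * d)))

partialE : ℕ → ℕ → Series
partialE d = prod (X ↑ d) (X ↑ d)

cube : Series → Series
cube a = a · a · a

T-progression : ∀ d n → T (X ↑ d · (X ↑ d) ↑ n) ≈ X ↑ (3 * d) · (X ↑ (3 * d)) ↑ n
T-progression d n = ≈-trans (T-· (X ↑ d) ((X ↑ d) ↑ n)) (·-cong step (≈-trans (T-↑ (X ↑ d) n) (↑-cong n step)))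
  where
  step : T (X ↑ d) ≈ X ↑ (3 * d)
  step = ≈-trans (T-X↑ d) (SR.reflexive (cong (X ↑_) (ℕₚ.*-comm d 3)))

-- Among the factors 1 - q^(dk), those with 3 not dividing k are covered by the two hypotheses,
-- while k = 3j turns into (1 - q^(dj))³. The factors k = 3j thus missing from the norm are supplied
-- by `partialE (3 * d) n`, so that nothing has to be divided.
norm-partialE : ∀ d g →
  (∀ n → NormFixed (oneMinus (X ↑ d · (X ↑ d) ↑ (n * 3)))) →
  (∀ n → NormFixed (oneMinus (X ↑ d · (X ↑ d) ↑ (1 + n * 3)))) →
  ∀ n → norm (g · partialE d (n * 3)) · partialE (3 * d) n ≈ norm g · partialE d (n * 3) · cube (partialE d n)
norm-partialE d g fix₀ fix₁ zero = ≈-trans (·-congʳ oneS (norm-cong (·-identityʳ g)))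
  (identity 1 (λ g → g :* con (+ 1) := g :* con (+ 1) :* (con (+ 1) :* con (+ 1) :* con (+ 1))) refl (norm g))
norm-partialE d g fix₀ fix₁ (suc n) = begin
  norm (g · (P · f₀ · f₁ · f₂)) · (R · r)
    ≈⟨ ·-cong (≈-trans (norm-cong (≈-trans
         (identity 5 (λ g p x y z → g :* (p :* x :* y :* z) := g :* p :* x :* y :* z) refl g P f₀ f₁ f₂)
         (·-congˡ (g · P · f₀ · f₁) (oneMinus-cong f₂≈T))))
       (≈-trans (norm-oneMinus₀ y (g · P · f₀ · f₁)) (·-congʳ (cube (oneMinus y)) (≈-trans (fix₁ n (g · P · f₀)) (·-congʳ f₁ (fix₀ n (g · P)))))))
       (·-congˡ R (oneMinus-cong (≈-trans (≈-sym (T-progression d n)) (≈-sym f₂≈T)))) ⟩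
  norm (g · P) · f₀ · f₁ · cube (oneMinus y) · (R · f₂)
    ≈⟨ identity 6 (λ m x y z r w → m :* x :* y :* (z :* z :* z) :* (r :* w) := m :* r :* (x :* y :* w) :* (z :* z :* z)) refl
         (norm (g · P)) f₀ f₁ (oneMinus y) R f₂ ⟩
  norm (g · P) · R · (f₀ · f₁ · f₂) · cube (oneMinus y)
    ≈⟨ ·-congʳ (cube (oneMinus y)) (·-congʳ (f₀ · f₁ · f₂) (norm-partialE d g fix₀ fix₁ n)) ⟩
  norm g · P · cube S · (f₀ · f₁ · f₂) · cube (oneMinus y)
    ≈⟨ identity 7 (λ m p s x y w z → m :* p :* (s :* s :* s) :* (x :* y :* w) :* (z :* z :* z)
         := m :* (p :* x :* y :* w) :* ((s :* z) :* (s :* z) :* (s :* z))) refl (norm g) P S f₀ f₁ f₂ (oneMinus y) ⟩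
  norm g · (P · f₀ · f₁ · f₂) · cube (S · oneMinus y) ∎
  where
  open ≈-Reasoning
  P = partialE d (n * 3)
  S = partialE d n
  R = partialE (3 * d) n
  y = X ↑ d · (X ↑ d) ↑ n
  r = oneMinus (X ↑ (3 * d) · (X ↑ (3 * d)) ↑ n)
  f₀ = oneMinus (X ↑ d · (X ↑ d) ↑ (n * 3))
  f₁ = oneMinus (X ↑ d · (X ↑ d) ↑ (1 + n * 3))
  f₂ = oneMinus (X ↑ d · (X ↑ d) ↑ (2 + n * 3))
  f₂≈T : X ↑ d · (X ↑ d) ↑ (2 + n * 3) ≈ T y
  f₂≈T = begin
    X ↑ d · (X ↑ d) ↑ (2 + n * 3)
      ≈⟨ identity 2 (λ x z → x :* (z :* x :* x) := x :* x :* x :* z) refl (X ↑ d) ((X ↑ d) ↑ (n * 3)) ⟩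
    cube (X ↑ d) · (X ↑ d) ↑ (n * 3)
      ≈⟨ ·-cong (≈-sym (T-cube d)) (≈-trans (↑-* (X ↑ d) n 3) (↑-cong n (≈-trans
           (identity 1 (λ x → con (+ 1) :* x :* x :* x := x :* x :* x) refl (X ↑ d)) (≈-sym (T-cube d))))) ⟩
    T (X ↑ d) · T (X ↑ d) ↑ n
      ≈⟨ ·-congˡ (T (X ↑ d)) (T-↑ (X ↑ d) n) ⟨
    T (X ↑ d) · T ((X ↑ d) ↑ n)
      ≈⟨ T-· (X ↑ d) ((X ↑ d) ↑ n) ⟨
    T y ∎

E-approx : ∀ d {K N} → K ≤ N → E (suc d) ≈[ K ] partialE (suc d) N
E-approx d K≤N = prod∞-approx (X ↑ suc d) (X ↑ suc d) (X↑-order d) K≤N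

norm-E : ∀ d g →
  (∀ n → NormFixed (oneMinus (X ↑ suc d · (X ↑ suc d) ↑ (n * 3)))) →
  (∀ n → NormFixed (oneMinus (X ↑ suc d · (X ↑ suc d) ↑ (1 + n * 3)))) →
  norm (g · E (suc d)) · E (3 * suc d) ≈ norm g · E (suc d) · cube (E (suc d))
norm-E d g fix₀ fix₁ = []⇒≈ λ K → []-trans
  (·-cong[] (norm-cong[] (·-cong[] []-refl (E-approx d ℕₚ.≤-refl))) (E-approx (d + 2 * suc d) ℕₚ.≤-refl))
  ([]-trans (≈⇒[] (norm-partialE (suc d) g fix₀ fix₁ K))
    ([]-sym (·-cong[] (·-cong[] []-refl (E-approx d (ℕₚ.m≤m*n K 3)))
      (·-cong[] (·-cong[] (E-approx d ℕₚ.≤-refl) (E-approx d ℕₚ.≤-refl)) (E-approx d ℕₚ.≤-refl)))))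

norm-one : norm oneS ≈ oneS
norm-one = ≈-trans (norm-dissected (begin
  oneS
    ≈⟨ identity 1 (λ x → con (+ 1) := con (+ 1) :+ x :* con (+ 0) :+ x :* x :* con (+ 0)) refl X ⟩
  oneS ⊕ X · zeroS ⊕ X · X · zeroS
    ≈⟨ ⊕-cong (⊕-cong T-one (·-congˡ X (T-embed (+ 0)))) (·-congˡ (X · X) (T-embed (+ 0))) ⟨
  dissected oneS zeroS zeroS ∎))
  (identity 1 (λ x → cubicNormₚ x (con (+ 1)) (con (+ 0)) (con (+ 0)) := con (+ 1)) refl X)
  where open ≈-Reasoning

norm-E₁E₂ : norm (E 1 · E 2) · (E 3 · E 6) ≈ E 1 ↑ 4 · E 2 ↑ 4
norm-E₁E₂ = begin
  norm (E 1 · E 2) · (E 3 · E 6)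
    ≈⟨ identity 3 (λ n e f → n :* (e :* f) := n :* f :* e) refl (norm (E 1 · E 2)) (E 3) (E 6) ⟩
  norm (E 1 · E 2) · E 6 · E 3
    ≈⟨ ·-congʳ (E 3) (norm-E 1 (E 1)
         -- For d = 2 the two residue classes change places: 2(3n + 1) = 2 + 3(2n) and 2(3n + 2) = 1
         -- + 3(2n + 1).
         (λ n → normFixed-cong (oneMinus-cong (≈-trans (SR.reflexive (cong (X ↑_) (cong (λ m → 2 + m) (2*3 n)))) (≈-sym (X↑-progression 2 (n * 3))))) (normFixed₂ (n * 2)))
         (λ n → normFixed-cong (oneMinus-cong (≈-trans (SR.reflexive (cong (X ↑_) (cong (λ m → 4 + m) (2*3 n)))) (≈-sym (X↑-progression 2 (1 + n * 3))))) (normFixed₁ (1 + n * 2)))) ⟩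
  norm (E 1) · E 2 · cube (E 2) · E 3
    ≈⟨ identity 3 (λ n e f → n :* e :* (e :* e :* e) :* f := n :* f :* (e :* (e :* e :* e))) refl (norm (E 1)) (E 2) (E 3) ⟩
  norm (E 1) · E 3 · (E 2 · cube (E 2))
    ≈⟨ ·-congʳ (E 2 · cube (E 2)) (≈-trans (·-congʳ (E 3) (norm-cong (≈-sym (·-identityˡ (E 1))))) (norm-E 0 oneS
         (λ n → normFixed-cong (oneMinus-cong (≈-trans (SR.reflexive (cong (X ↑_) (cong suc (sym (ℕₚ.*-identityʳ (n * 3)))))) (≈-sym (X↑-progression 1 (n * 3))))) (normFixed₁ n))
         (λ n → normFixed-cong (oneMinus-cong (≈-trans (SR.reflexive (cong (X ↑_) (cong (λ m → 2 + m) (sym (ℕₚ.*-identityʳ (n * 3)))))) (≈-sym (X↑-progression 1 (1 + n * 3))))) (normFixed₂ n)))) ⟩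
  norm oneS · E 1 · cube (E 1) · (E 2 · cube (E 2))
    ≈⟨ ·-congʳ (E 2 · cube (E 2)) (·-congʳ (cube (E 1)) (·-congʳ (E 1) norm-one)) ⟩
  oneS · E 1 · cube (E 1) · (E 2 · cube (E 2))
    ≈⟨ identity 2 (λ e f → con (+ 1) :* e :* (e :* e :* e) :* (f :* (f :* f :* f))
         := (con (+ 1) :* e :* e :* e :* e) :* (con (+ 1) :* f :* f :* f :* f)) refl (E 1) (E 2) ⟩
  E 1 ↑ 4 · E 2 ↑ 4 ∎
  where
  open ≈-Reasoning
  2*3 : ∀ n → n * 2 * 3 ≡ n * 3 * 2
  2*3 n = trans (ℕₚ.*-assoc n 2 3) (sym (ℕₚ.*-assoc n 3 2))

-- The Jacobi triple product

-- (-u)^j Q^(j(j-1)/2). When u v = Q, the terms of the bilateral theta series with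
-- positive index are the powers of u and those with negative index the powers of v.
power : Series → Series → ℕ → Series
power u Q zero    = oneS
power u Q (suc j) = power u Q j · ⊖ (u · Q ↑ j)

-- The value at 0 is 2, whereas `theta` counts the index 0 once. The 2 is what the recurrence for
-- neighbouring indices requires, because 0 is adjacent to both 1 and -1.
pair : Series → Series → Series → ℕ → Series
pair u v Q j = power u Q j ⊕ power v Q j

theta : Series → Series → Series → ℕ → Series
theta u v Q zero    = oneS
theta u v Q (suc n) = theta u v Q n ⊕ pair u v Q (suc n)

module TripleProduct (u v Q : Series) (uv≈Q : u · v ≈ Q) (Q-order : Q ≈[ 1 ] zeroS) where

  p q r g h : ℕ → Series
  p = power u Q
  q = power v Q
  r = pair u v Q
  g = prod Q Q
  h n = inv (g n)

  g·h : ∀ n → g n · h n ≈ oneS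
  g·h n = proj₂ (Inv-unit (g n) (prod-zero Q Q n (at[] Q-order 0 ℕₚ.≤-refl)))

  h-suc : ∀ n → h n ≈ h (suc n) · oneMinus (Q ↑ suc n)
  h-suc n = begin
    h n                                                   ≈⟨ ·-identityʳ (h n) ⟨
    h n · oneS                                            ≈⟨ ·-congˡ (h n) (g·h (suc n)) ⟨
    h n · (g n · oneMinus (Q · Q ↑ n) · h (suc n))
      ≈⟨ identity 4 (λ h g m k → h :* (g :* m :* k) := g :* h :* (k :* m)) refl (h n) (g n) (oneMinus (Q · Q ↑ n)) (h (suc n)) ⟩
    g n · h n · (h (suc n) · oneMinus (Q · Q ↑ n))        ≈⟨ ·-cong (g·h n) (·-congˡ (h (suc n)) (oneMinus-cong (·-comm Q (Q ↑ n)))) ⟩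
    oneS · (h (suc n) · oneMinus (Q ↑ suc n))             ≈⟨ ·-identityˡ _ ⟩
    h (suc n) · oneMinus (Q ↑ suc n)                      ∎
    where open ≈-Reasoning

  -- A factor -u Q^(j+1) raises the index of a u-term from j + 1 to j + 2. A factor -v Q^(j+1)
  -- lowers it to j, since u v = Q cancels the last u; the v-terms behave symmetrically.
  r-recurrence : ∀ j x → ⊖ ((u ⊕ v) · (Q ↑ suc j · x)) · r (suc j) ≈ x · r (suc (suc j)) ⊕ Q ↑ suc j · Q ↑ suc j · x · r j
  r-recurrence j x = ≈-trans
    (identity 7 (λ u v z Q x p q →
        :- ((u :+ v) :* (z :* Q :* x)) :* (p :* :- (u :* z) :+ q :* :- (v :* z))
        := (x :* (p :* :- (u :* z) :* :- (u :* (z :* Q)) :+ q :* :- (v :* z) :* :- (v :* (z :* Q)))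
           :+ u :* v :* (z :* (z :* Q) :* x :* (p :+ q)))) refl
      u v (Q ↑ j) Q x (p j) (q j))
    (⊕-congˡ (x · r (suc (suc j))) (≈-trans (·-congʳ _ uv≈Q)
      (identity 4 (λ Q z x r → Q :* (z :* (z :* Q) :* x :* r) := z :* Q :* (z :* Q) :* x :* r) refl Q (Q ↑ j) x (r j))))

  factors : Series → Series
  factors n = oneMinus (u · n) · oneMinus (v · n)

  factors≈ : ∀ n → factors n ≈ oneS ⊕ n · n · Q ⊕ ⊖ ((u ⊕ v) · n)
  factors≈ n = ≈-trans
    (identity 3 (λ u v n → (con (+ 1) :- u :* n) :* (con (+ 1) :- v :* n) := con (+ 1) :+ n :* n :* (u :* v) :- (u :+ v) :* n) refl u v n)
    (⊕-congʳ _ (⊕-congˡ oneS (·-congˡ (n · n) uv≈Q)))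

  -- Up to the factor (Q;Q)_{2N}, the terms |i| ≤ j of the q-binomial
  -- expansion of order N = j + d.
  expansion : ℕ → ℕ → Series
  expansion zero    d = h d · h d
  expansion (suc j) d = expansion j (suc d) ⊕ h d · h (suc j * 2 + d) · r (suc j)

  step : Series → Series
  step n = oneMinus (n · n · Q) · oneMinus (n · n · Q · Q)

  -- Cutting both expansions at j leaves one boundary term on each side; the
  -- left one carries a factor 1 - Q^d and so disappears at d = 0.
  expansion-step : ∀ j d →
    factors (Q ↑ j · Q ↑ d) · expansion j d
      ⊕ Q ↑ j · Q ↑ j · Q ↑ suc d · (h (suc d) · oneMinus (Q ↑ d) · oneMinus (Q ↑ suc d) · h (suc (j * 2 + d))) · r j
    ≈ step (Q ↑ j · Q ↑ d) · expansion j (suc d) ⊕ Q ↑ d · (h d · h (j * 2 + d)) · r (suc j)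
  expansion-step zero d = begin
    factors (oneS · x) · (h d · h d) ⊕ oneS · oneS · (x · Q) · (H · oneMinus x · oneMinus (x · Q) · H) · (oneS ⊕ oneS)
      ≈⟨ ⊕-congʳ _ (·-cong (factors≈ (oneS · x)) (·-cong (h-suc d) (h-suc d))) ⟩
    (oneS ⊕ oneS · x · (oneS · x) · Q ⊕ ⊖ ((u ⊕ v) · (oneS · x))) · (H · oneMinus (x · Q) · (H · oneMinus (x · Q)))
      ⊕ oneS · oneS · (x · Q) · (H · oneMinus x · oneMinus (x · Q) · H) · (oneS ⊕ oneS)
      ≈⟨ identity 5 (λ x Q u v H → let 𝟙 = con (+ 1) ; n = 𝟙 :* x in
           (𝟙 :+ n :* n :* Q :- (u :+ v) :* n) :* (H :* (𝟙 :- x :* Q) :* (H :* (𝟙 :- x :* Q)))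
             :+ 𝟙 :* 𝟙 :* (x :* Q) :* (H :* (𝟙 :- x) :* (𝟙 :- x :* Q) :* H) :* (𝟙 :+ 𝟙)
           := (𝟙 :- n :* n :* Q) :* (𝟙 :- n :* n :* Q :* Q) :* (H :* H)
             :+ x :* (H :* (𝟙 :- x :* Q) :* (H :* (𝟙 :- x :* Q))) :* (𝟙 :* :- (u :* 𝟙) :+ 𝟙 :* :- (v :* 𝟙))) refl x Q u v H ⟩
    step (oneS · x) · (H · H) ⊕ x · (H · oneMinus (x · Q) · (H · oneMinus (x · Q))) · r 1
      ≈⟨ ⊕-congˡ _ (·-congʳ (r 1) (·-congˡ x (·-cong (h-suc d) (h-suc d)))) ⟨
    step (oneS · x) · (H · H) ⊕ x · (h d · h d) · r 1 ∎
    where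
    open ≈-Reasoning
    x = Q ↑ d
    H = h (suc d)
  expansion-step (suc j) d = begin
    factors (z · Q · x) · (A ⊕ h d · h (2 + m) · r₁) ⊕ z · Q · (z · Q) · (x · Q) · (H · oneMinus x · oneMinus (x · Q) · K) · r₁
      ≈⟨ ⊕-congʳ _ (·-cong (factors≈ (z · Q · x)) (⊕-congˡ A (·-congʳ r₁ (·-cong hd hm₂)))) ⟩
    (oneS ⊕ z · Q · x · (z · Q · x) · Q ⊕ s) · (A ⊕ H · (oneMinus (x · Q)) · (K · oneMinus (y · Q)) · r₁)
      ⊕ z · Q · (z · Q) · (x · Q) · (H · oneMinus x · oneMinus (x · Q) · K) · r₁
      ≈⟨ identity 8 (λ z x Q H K A r s → let 𝟙 = con (+ 1) ; n = z :* Q :* x ; y = z :* Q :* (z :* Q) :* x in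
           (𝟙 :+ n :* n :* Q :+ s) :* (A :+ H :* (𝟙 :- x :* Q) :* (K :* (𝟙 :- y :* Q)) :* r)
             :+ z :* Q :* (z :* Q) :* (x :* Q) :* (H :* (𝟙 :- x) :* (𝟙 :- x :* Q) :* K) :* r
           := (𝟙 :+ n :* n :* Q :+ s) :* A
             :+ ((𝟙 :+ n :* n :* Q) :* (H :* (𝟙 :- x :* Q) :* (K :* (𝟙 :- y :* Q))) :* r
                :+ z :* Q :* (z :* Q) :* (x :* Q) :* (H :* (𝟙 :- x) :* (𝟙 :- x :* Q) :* K) :* r)
             :+ H :* (𝟙 :- x :* Q) :* (K :* (𝟙 :- y :* Q)) :* (s :* r)) refl z x Q H K A r₁ s ⟩
    L · A ⊕ (W₁ · r₁ ⊕ W₂ · r₁) ⊕ H · oneMinus (x · Q) · (K · oneMinus (y · Q)) · (s · r₁)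
      -- The middle term of `factors`, applied to the outermost summand, splits between its
      -- neighbours: `r₂` becomes the new right boundary, and `r₀` is the left boundary that the
      -- induction hypothesis expects.
      ≈⟨ ⊕-congˡ _ (·-congˡ _ (r-recurrence j x)) ⟩
    L · A ⊕ (W₁ · r₁ ⊕ W₂ · r₁) ⊕ H · oneMinus (x · Q) · (K · oneMinus (y · Q)) · (x · r₂ ⊕ y · r₀)
      ≈⟨ identity 8 (λ LA Wr e f x y r₂ r₀ → LA :+ Wr :+ e :* f :* (x :* r₂ :+ y :* r₀)
           := LA :+ y :* (e :* f) :* r₀ :+ (Wr :+ x :* (e :* f) :* r₂)) refl
           (L · A) (W₁ · r₁ ⊕ W₂ · r₁) (H · oneMinus (x · Q)) (K · oneMinus (y · Q)) x y r₂ r₀ ⟩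
    L · A ⊕ y · (H · oneMinus (x · Q) · (K · oneMinus (y · Q))) · r₀ ⊕ (W₁ · r₁ ⊕ W₂ · r₁ ⊕ x · (H · oneMinus (x · Q) · (K · oneMinus (y · Q))) · r₂)
      ≈⟨ ⊕-cong induction (⊕-congˡ _ (·-congʳ r₂ (·-congˡ x (≈-sym (·-cong hd hm₂))))) ⟩
    step (z · Q · x) · B ⊕ x · Q · (H · (K · oneMinus (y · Q) · oneMinus y)) · r₁ ⊕ (W₁ · r₁ ⊕ W₂ · r₁ ⊕ x · (h d · h (2 + m)) · r₂)
      -- The three contributions to `r₁` add up to `step` times `H · K`, which is the coefficient of
      -- that summand in the expansion of the next order.
      ≈⟨ identity 8 (λ z x Q H K B r e → let 𝟙 = con (+ 1) ; n = z :* Q :* x ; y = z :* Q :* (z :* Q) :* x in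
           (𝟙 :- n :* n :* Q) :* (𝟙 :- n :* n :* Q :* Q) :* B :+ x :* Q :* (H :* (K :* (𝟙 :- y :* Q) :* (𝟙 :- y))) :* r
             :+ ((𝟙 :+ n :* n :* Q) :* (H :* (𝟙 :- x :* Q) :* (K :* (𝟙 :- y :* Q))) :* r
                :+ z :* Q :* (z :* Q) :* (x :* Q) :* (H :* (𝟙 :- x) :* (𝟙 :- x :* Q) :* K) :* r
                :+ e)
           := (𝟙 :- n :* n :* Q) :* (𝟙 :- n :* n :* Q :* Q) :* (B :+ H :* K :* r) :+ e) refl
           z x Q H K B r₁ (x · (h d · h (2 + m)) · r₂) ⟩
    step (z · Q · x) · (B ⊕ H · K · r₁) ⊕ x · (h d · h (2 + m)) · r₂
      ≈⟨ ⊕-congʳ _ (·-congˡ (step (z · Q · x)) (⊕-congˡ B (·-congʳ r₁ (·-congˡ H (SR.reflexive (cong (h ∘ suc ∘ suc) (sym (ℕₚ.+-suc (j * 2) d)))))))) ⟩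
    step (z · Q · x) · (B ⊕ H · h (2 + (j * 2 + suc d)) · r₁) ⊕ x · (h d · h (2 + m)) · r₂ ∎
    where
    open ≈-Reasoning
    m = j * 2 + d
    z = Q ↑ j
    x = Q ↑ d
    y = z · Q · (z · Q) · x
    s = ⊖ ((u ⊕ v) · (z · Q · x))
    H = h (suc d)
    K = h (3 + m)
    A = expansion j (suc d)
    B = expansion j (suc (suc d))
    L = oneS ⊕ z · Q · x · (z · Q · x) · Q ⊕ s
    r₀ = r j
    r₁ = r (suc j)
    r₂ = r (suc (suc j))
    W₁ = (oneS ⊕ z · Q · x · (z · Q · x) · Q) · (H · oneMinus (x · Q) · (K · oneMinus (y · Q)))
    W₂ = z · Q · (z · Q) · (x · Q) · (H · oneMinus x · oneMinus (x · Q) · K)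
    hd : h d ≈ H · oneMinus (x · Q)
    hd = h-suc d
    Q↑m : Q ↑ m ≈ z · z · x
    Q↑m = ≈-trans (↑-+ Q (j * 2) d) (·-congʳ x (≈-trans (SR.reflexive (cong (Q ↑_) (ℕₚ.*-comm j 2)))
      (≈-trans (↑-* Q 2 j) (·-congʳ z (·-identityˡ z)))))
    y≈ : Q ↑ (2 + m) ≈ y
    y≈ = ≈-trans (·-congʳ Q (·-congʳ Q Q↑m)) (identity 3 (λ z x Q → z :* z :* x :* Q :* Q := z :* Q :* (z :* Q) :* x) refl z x Q)
    hm₂ : h (2 + m) ≈ K · oneMinus (y · Q)
    hm₂ = ≈-trans (h-suc (2 + m)) (·-congˡ K (oneMinus-cong (·-congʳ Q y≈)))
    hm₁ : h (1 + m) ≈ K · oneMinus (y · Q) · oneMinus y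
    hm₁ = ≈-trans (h-suc (1 + m)) (·-cong hm₂ (oneMinus-cong y≈))
    n≈ : z · Q · x ≈ z · (x · Q)
    n≈ = identity 3 (λ z x Q → z :* Q :* x := z :* (x :* Q)) refl z x Q
    m′ : j * 2 + suc d ≡ suc m
    m′ = ℕₚ.+-suc (j * 2) d
    step-cong : ∀ {n n′} → n ≈ n′ → step n ≈ step n′
    step-cong e = ·-cong (oneMinus-cong (·-congʳ Q (·-cong e e))) (oneMinus-cong (·-congʳ Q (·-congʳ Q (·-cong e e))))
    induction : L · A ⊕ y · (H · oneMinus (x · Q) · (K · oneMinus (y · Q))) · r₀
              ≈ step (z · Q · x) · B ⊕ x · Q · (H · (K · oneMinus (y · Q) · oneMinus y)) · r₁
    induction = begin
      L · A ⊕ y · (H · oneMinus (x · Q) · (K · oneMinus (y · Q))) · r₀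
        ≈⟨ ⊕-cong (·-congʳ A (≈-trans (≈-sym (factors≈ (z · Q · x))) (·-cong (oneMinus-cong (·-congˡ u n≈)) (oneMinus-cong (·-congˡ v n≈)))))
             (·-congʳ r₀ (·-cong (identity 3 (λ z x Q → z :* Q :* (z :* Q) :* x := z :* z :* (x :* Q :* Q)) refl z x Q)
               (≈-trans (·-cong (·-congʳ _ (h-suc (suc d))) (≈-sym (≈-trans (SR.reflexive (cong (h ∘ suc) m′)) hm₂)))
                 (identity 4 (λ a b c d → a :* b :* c :* d := a :* c :* b :* d) refl (h (suc (suc d))) (oneMinus (Q ↑ suc (suc d))) (oneMinus (x · Q)) (h (suc (j * 2 + suc d))))))) ⟩
      factors (z · Q ↑ suc d) · A ⊕ z · z · Q ↑ suc (suc d) · (h (suc (suc d)) · oneMinus (Q ↑ suc d) · oneMinus (Q ↑ suc (suc d)) · h (suc (j * 2 + suc d))) · r₀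
        ≈⟨ expansion-step j (suc d) ⟩
      step (z · Q ↑ suc d) · B ⊕ Q ↑ suc d · (H · h (j * 2 + suc d)) · r₁
        ≈⟨ ⊕-cong (·-congʳ B (step-cong (≈-sym n≈))) (·-congʳ r₁ (·-congˡ (x · Q) (·-congˡ H (≈-trans (SR.reflexive (cong h m′)) hm₁)))) ⟩
      step (z · Q · x) · B ⊕ x · Q · (H · (K · oneMinus (y · Q) · oneMinus y)) · r₁ ∎

  -- The q-binomial theorem in symmetric form: the coefficient of the summand of index i is
  -- (Q;Q)_{2n} / ((Q;Q)_{n-i} (Q;Q)_{n+i}). Going from n to n + 1 multiplies the left side by
  -- `factors` and (Q;Q)_{2n} by `step`, and `expansion-step` compares the two.
  finite : ∀ n → prod u Q n · prod v Q n ≈ g (n * 2) · expansion n 0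
  finite zero    = ≈-trans (·-identityˡ oneS) (≈-sym (≈-trans (·-congˡ oneS (·-cong h₀ h₀)) (≈-trans (·-identityˡ _) (·-identityˡ oneS))))
    where
    h₀ : h 0 ≈ oneS
    h₀ = ≈-trans (≈-sym (·-identityˡ (h 0))) (g·h 0)
  finite (suc n) = begin
    prod u Q n · oneMinus (u · Q ↑ n) · (prod v Q n · oneMinus (v · Q ↑ n))
      ≈⟨ identity 4 (λ a b c d → a :* b :* (c :* d) := a :* c :* (b :* d)) refl (prod u Q n) (oneMinus (u · Q ↑ n)) (prod v Q n) (oneMinus (v · Q ↑ n)) ⟩
    prod u Q n · prod v Q n · factors (Q ↑ n)
      ≈⟨ ·-cong (finite n) (·-cong (oneMinus-cong (·-congˡ u n≈)) (oneMinus-cong (·-congˡ v n≈))) ⟩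
    g (n * 2) · expansion n 0 · factors (Q ↑ n · oneS)
      ≈⟨ identity 3 (λ a b c → a :* b :* c := a :* (c :* b)) refl (g (n * 2)) (expansion n 0) (factors (Q ↑ n · oneS)) ⟩
    g (n * 2) · (factors (Q ↑ n · oneS) · expansion n 0)
      ≈⟨ ·-congˡ (g (n * 2)) (begin
           factors (Q ↑ n · oneS) · expansion n 0
             -- The term inserted here is zero through its factor 1 - Q^0; it is the left boundary
             -- term of `expansion-step` at d = 0.
             ≈⟨ identity 6 (λ f a b c d r → f := f :+ a :* (b :* (con (+ 1) :- con (+ 1)) :* c :* d) :* r) refl
                  (factors (Q ↑ n · oneS) · expansion n 0) (Q ↑ n · Q ↑ n · Q ↑ 1) (h 1) (oneMinus (Q ↑ 1)) (h (suc (n * 2 + 0))) (r n) ⟩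
           _ ≈⟨ expansion-step n 0 ⟩
           step (Q ↑ n · oneS) · expansion n 1 ⊕ oneS · (h 0 · h (n * 2 + 0)) · r (suc n)
             -- The right boundary term is the new outermost summand, because `step` removes the
             -- last two factors from the denominator (Q;Q)_{2n+2}.
             ≈⟨ ⊕-congˡ _ (·-congʳ (r (suc n)) boundary) ⟩
           step (Q ↑ n · oneS) · expansion n 1 ⊕ step (Q ↑ n · oneS) · (h 0 · h (suc n * 2 + 0)) · r (suc n)
             ≈⟨ identity 4 (λ s e h r → s :* e :+ s :* h :* r := s :* (e :+ h :* r)) refl (step (Q ↑ n · oneS)) (expansion n 1) _ (r (suc n)) ⟩
           step (Q ↑ n · oneS) · expansion (suc n) 0 ∎) ⟩
    g (n * 2) · (step (Q ↑ n · oneS) · expansion (suc n) 0)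
      ≈⟨ ≈-trans (≈-sym (·-assoc _ _ _)) (·-congʳ (expansion (suc n) 0) (≈-trans (·-congˡ (g (n * 2)) step≈) (≈-sym (·-assoc _ _ _)))) ⟩
    g (suc n * 2) · expansion (suc n) 0 ∎
    where
    open ≈-Reasoning
    n≈ : Q ↑ n ≈ Q ↑ n · oneS
    n≈ = ≈-sym (·-identityʳ (Q ↑ n))
    double : Q ↑ n · oneS · (Q ↑ n · oneS) ≈ Q ↑ (n * 2)
    double = ≈-trans (identity 1 (λ x → x :* con (+ 1) :* (x :* con (+ 1)) := con (+ 1) :* x :* x) refl (Q ↑ n))
      (≈-trans (≈-sym (↑-* Q 2 n)) (SR.reflexive (cong (Q ↑_) (ℕₚ.*-comm 2 n))))
    step≈ : step (Q ↑ n · oneS) ≈ oneMinus (Q · Q ↑ (n * 2)) · oneMinus (Q · Q ↑ suc (n * 2))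
    step≈ = ·-cong (oneMinus-cong (≈-trans (·-congʳ Q double) (·-comm _ Q)))
      (oneMinus-cong (≈-trans (·-congʳ Q (·-congʳ Q double)) (·-comm _ Q)))
    boundary : oneS · (h 0 · h (n * 2 + 0)) ≈ step (Q ↑ n · oneS) · (h 0 · h (suc n * 2 + 0))
    boundary = ≈-trans (·-congˡ oneS (·-congˡ (h 0) (begin
        h (n * 2 + 0)
          ≈⟨ SR.reflexive (cong h (ℕₚ.+-identityʳ (n * 2))) ⟩
        h (n * 2)
          ≈⟨ ≈-trans (h-suc (n * 2)) (·-congʳ _ (h-suc (suc (n * 2)))) ⟩
        h (suc n * 2) · oneMinus (Q ↑ suc (suc (n * 2))) · oneMinus (Q ↑ suc (n * 2))
          ≈⟨ ·-cong (·-cong (SR.reflexive (cong (h ∘ suc ∘ suc) (sym (ℕₚ.+-identityʳ (n * 2)))))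
               (oneMinus-cong (·-congʳ Q (·-congʳ Q (≈-sym double))))) (oneMinus-cong (·-congʳ Q (≈-sym double))) ⟩
        h (suc n * 2 + 0) · oneMinus (m · Q · Q) · oneMinus (m · Q) ∎)))
      (identity 4 (λ a b c d → con (+ 1) :* (a :* (b :* c :* d)) := d :* c :* (a :* b)) refl (h 0) (h (suc n * 2 + 0)) (oneMinus (m · Q · Q)) (oneMinus (m · Q)))
      where m = Q ↑ n · oneS · (Q ↑ n · oneS)

-- Since u may be a unit, only Q contributes to the order; the last factor alone gives q^j.
power-order : ∀ u Q j → Q ≈[ 1 ] zeroS → power u Q (suc j) ≈[ j ] zeroS
power-order u Q j Q0 = ·-order {power u Q j} 0 j (mk[] λ _ ()) ([]-trans
  (⊖-cong[] (·-order {u} 0 j (mk[] λ _ ()) (↑-order j Q0))) (≈⇒[] (identity 0 (:- con (+ 0) := con (+ 0)) refl)))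

-- The finite form multiplied by (Q;Q)_N. Stating the limit through partial sums modulo q^K spares a
-- definition of the infinite bilateral sum. With N at least 2K, each index is either so large that
-- its term vanishes or at distance at least K from N.
jacobi : ∀ u v Q → u · v ≈ Q → Q ≈[ 1 ] zeroS → ∀ {K N} → K + K ≤ N →
  prod∞ u Q · prod∞ v Q · prod∞ Q Q ≈[ K ] theta u v Q N
jacobi u v Q uv≈Q Q0 {K} {N} K+K≤N = begin
  prod∞ u Q · prod∞ v Q · prod∞ Q Q
    ≈⟨ ·-cong[] (·-cong[] (prod∞-approx u Q Q0 K≤N) (prod∞-approx v Q Q0 K≤N)) (prod∞-approx Q Q Q0 K≤N) ⟩
  prod u Q N · prod v Q N · g N
    ≈⟨ ≈⇒[] (≈-trans (·-congʳ (g N) (finite N))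
         (identity 3 (λ a b c → a :* b :* c := a :* c :* b) refl (g (N * 2)) (expansion N 0) (g N))) ⟩
  g (N * 2) · g N · expansion N 0
    ≈⟨ normalised N 0 (subst (K + K ≤_) (sym (ℕₚ.+-identityʳ N)) K+K≤N) (·-cong[] (g≈ (ℕₚ.≤-trans K≤N (ℕₚ.m≤m*n N 2))) (g≈ K≤N)) ⟩
  theta u v Q N ∎
  where
  open TripleProduct u v Q uv≈Q Q0
  open SetoidReasoning ([]-setoid K)
  K≤N : K ≤ N
  K≤N = ℕₚ.≤-trans (ℕₚ.m≤m+n K K) K+K≤N
  g≈ : ∀ {n} → K ≤ n → g n ≈[ K ] g K
  g≈ K≤n = []-sym (prod-stable Q Q Q0 K≤n)
  h≈ : ∀ {n} → K ≤ n → h n ≈[ K ] h K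
  h≈ {n} K≤n = begin
    h n                 ≈⟨ ≈⇒[] (·-identityʳ (h n)) ⟨
    h n · oneS          ≈⟨ ≈⇒[] (·-congˡ (h n) (g·h K)) ⟨
    h n · (g K · h K)   ≈⟨ ·-cong[] []-refl (·-cong[] (g≈ K≤n) []-refl) ⟨
    h n · (g n · h K)   ≈⟨ ≈⇒[] (identity 3 (λ a b c → a :* (b :* c) := b :* a :* c) refl (h n) (g n) (h K)) ⟩
    g n · h n · h K     ≈⟨ ≈⇒[] (≈-trans (·-congʳ (h K) (g·h n)) (·-identityˡ (h K))) ⟩
    h K                 ∎
  unit : ∀ {c m n} → c ≈[ K ] g K · g K → K ≤ m → K ≤ n → c · (h m · h n) ≈[ K ] oneS
  unit {c} {m} {n} p K≤m K≤n = begin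
    c · (h m · h n)              ≈⟨ ·-cong[] p (·-cong[] (h≈ K≤m) (h≈ K≤n)) ⟩
    g K · g K · (h K · h K)      ≈⟨ ≈⇒[] (identity 2 (λ g h → g :* g :* (h :* h) := g :* h :* (g :* h)) refl (g K) (h K)) ⟩
    g K · h K · (g K · h K)      ≈⟨ ≈⇒[] (≈-trans (·-cong (g·h K) (g·h K)) (·-identityˡ oneS)) ⟩
    oneS                         ∎
  r-order : ∀ j → r (suc j) ≈[ j ] zeroS
  r-order j = []-trans (⊕-cong[] (power-order u Q j Q0) (power-order v Q j Q0)) (≈⇒[] (identity 0 (con (+ 0) :+ con (+ 0) := con (+ 0)) refl))
  -- A term with j > K is divisible by X^K; otherwise d ≥ K and its
  -- coefficient is 1 modulo X^K.
  term : ∀ {c} j d → K + K ≤ suc j + d → c ≈[ K ] g K · g K → c · (h d · h (suc j * 2 + d)) · r (suc j) ≈[ K ] r (suc j)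
  term {c} j d le p with K ℕₚ.≤? j
  ... | yes K≤j = begin
    c · (h d · h (suc j * 2 + d)) · r (suc j)   ≈⟨ ·-cong[] []-refl ([]-weaken K≤j (r-order j)) ⟩
    c · (h d · h (suc j * 2 + d)) · zeroS       ≈⟨ ≈⇒[] (SR.zeroʳ _) ⟩
    zeroS                                         ≈⟨ []-weaken K≤j (r-order j) ⟨
    r (suc j)                                     ∎
  ... | no K≰j = begin
    c · (h d · h (suc j * 2 + d)) · r (suc j)   ≈⟨ ·-cong[] (unit p K≤d (ℕₚ.≤-trans K≤d (ℕₚ.m≤n+m d (suc j * 2)))) []-refl ⟩
    oneS · r (suc j)                              ≈⟨ ≈⇒[] (·-identityˡ (r (suc j))) ⟩
    r (suc j)                                     ∎
    where
    K≤d : K ≤ d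
    K≤d = ℕₚ.+-cancelˡ-≤ K _ _ (ℕₚ.≤-trans le (ℕₚ.+-monoˡ-≤ d (ℕₚ.≰⇒> K≰j)))
  normalised : ∀ j d {c} → K + K ≤ j + d → c ≈[ K ] g K · g K → c · expansion j d ≈[ K ] theta u v Q j
  normalised zero    d le p = unit p (ℕₚ.≤-trans (ℕₚ.m≤m+n K K) le) (ℕₚ.≤-trans (ℕₚ.m≤m+n K K) le)
  normalised (suc j) d {c} le p = begin
    c · (expansion j (suc d) ⊕ h d · h (suc j * 2 + d) · r (suc j))
      ≈⟨ ≈⇒[] (identity 4 (λ c e w r → c :* (e :+ w :* r) := c :* e :+ c :* w :* r) refl c (expansion j (suc d)) (h d · h (suc j * 2 + d)) (r (suc j))) ⟩
    c · expansion j (suc d) ⊕ c · (h d · h (suc j * 2 + d)) · r (suc j)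
      ≈⟨ ⊕-cong[] (normalised j (suc d) (subst (K + K ≤_) (sym (ℕₚ.+-suc j d)) le) p) (term j d le p) ⟩
    theta u v Q j ⊕ r (suc j) ∎

-- Theta functions and their 3-dissections

triple : Series → Series → Series → Series
triple u v Q = prod∞ u Q · prod∞ v Q · prod∞ Q Q

triple-cong : ∀ {u u′ v v′ Q Q′} → u ≈ u′ → v ≈ v′ → Q ≈ Q′ → triple u v Q ≈ triple u′ v′ Q′
triple-cong p q r = ·-cong (·-cong (prod∞-cong p r) (prod∞-cong q r)) (prod∞-cong r r)

triple-comm : ∀ u v Q → triple u v Q ≈ triple v u Q
triple-comm u v Q = ·-congʳ (prod∞ Q Q) (·-comm (prod∞ u Q) (prod∞ v Q))

T-triple : ∀ u v Q → Q ≈[ 1 ] zeroS → T (triple u v Q) ≈ triple (T u) (T v) (T Q)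
T-triple u v Q Q0 = ≈-trans (T-· (prod∞ u Q · prod∞ v Q) (prod∞ Q Q)) (·-cong
  (≈-trans (T-· (prod∞ u Q) (prod∞ v Q)) (·-cong (T-prod∞ u Q Q0) (T-prod∞ v Q Q0))) (T-prod∞ Q Q Q0))

cube-cong : ∀ {a b} → a ≈ b → cube a ≈ cube b
cube-cong p = ·-cong (·-cong p p) p

cube-↑ : ∀ a n → cube a ↑ n ≈ cube (a ↑ n)
cube-↑ a n = ≈-trans (·-↑ (a · a) a n) (·-congʳ (a ↑ n) (·-↑ a a n))

cube-order : ∀ {Q} → Q ≈[ 1 ] zeroS → cube Q ≈[ 1 ] zeroS
cube-order {Q} Q0 = []-weaken (s≤s z≤n) (·-order {Q · Q} {Q} 0 1 (mk[] λ _ ()) Q0)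

module ThetaDissection (Q : Series) where

  Q₉ : Series
  Q₉ = cube (cube Q)

  Q₉↑ : ∀ k → Q₉ ↑ k ≈ cube (Q ↑ (k * 3))
  Q₉↑ k = ≈-trans (cube-↑ (cube Q) k) (cube-cong (≈-trans
    (↑-cong k (identity 1 (λ q → q :* q :* q := con (+ 1) :* q :* q :* q) refl Q)) (≈-sym (↑-* Q k 3))))

  -- The exponents satisfy 3k(3k - 1)/2 = 9 k(k - 1)/2 + 3k, so the subsequence is again of theta
  -- type with base Q⁹; the 3k is absorbed as the cube of Q in the parameter.
  power₀ : ∀ u k → power u Q (k * 3) ≈ power (cube (u · Q)) Q₉ k
  power₀ u zero    = ≈-refl
  power₀ u (suc k) = ≈-trans
    (identity 4 (λ p u Q w → p :* :- (u :* w) :* :- (u :* (w :* Q)) :* :- (u :* (w :* Q :* Q))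
       := p :* :- (u :* Q :* (u :* Q) :* (u :* Q) :* (w :* w :* w))) refl (power u Q (k * 3)) u Q (Q ↑ (k * 3)))
    (·-cong (power₀ u k) (⊖-cong (·-congˡ (cube (u · Q)) (≈-sym (Q₉↑ k)))))

  power₁ : ∀ u k → power u Q (1 + k * 3) ≈ ⊖ u · power (cube (u · Q · Q)) Q₉ k
  power₁ u zero    = identity 1 (λ u → con (+ 1) :* :- (u :* con (+ 1)) := :- u :* con (+ 1)) refl u
  power₁ u (suc k) = ≈-trans
    (identity 4 (λ p u Q w → p :* :- (u :* (w :* Q)) :* :- (u :* (w :* Q :* Q)) :* :- (u :* (w :* Q :* Q :* Q))
       := p :* :- (u :* Q :* Q :* (u :* Q :* Q) :* (u :* Q :* Q) :* (w :* w :* w))) refl (power u Q (1 + k * 3)) u Q (Q ↑ (k * 3)))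
    (≈-trans (·-cong (power₁ u k) (⊖-cong (·-congˡ (cube (u · Q · Q)) (≈-sym (Q₉↑ k))))) (·-assoc _ _ _))

  -- The index 3k + 2 = 3(k + 1) - 1 belongs to the class of -1, whose central term is -v. Hence the
  -- shift to `suc k`, with v / Q standing for the inverse of u.
  power₂ : ∀ u v → u · v ≈ Q → ∀ k → power u Q (2 + k * 3) ≈ ⊖ v · power (cube u) Q₉ (suc k)
  power₂ u v uv zero    = begin
    oneS · ⊖ (u · oneS) · ⊖ (u · (oneS · Q))
      ≈⟨ identity 2 (λ u Q → con (+ 1) :* :- (u :* con (+ 1)) :* :- (u :* (con (+ 1) :* Q)) := Q :* (u :* u)) refl u Q ⟩
    Q · (u · u)
      ≈⟨ ·-congʳ (u · u) uv ⟨
    u · v · (u · u)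
      ≈⟨ identity 2 (λ u v → u :* v :* (u :* u) := :- v :* (con (+ 1) :* :- (u :* u :* u :* con (+ 1)))) refl u v ⟩
    ⊖ v · (oneS · ⊖ (cube u · oneS)) ∎
    where open ≈-Reasoning
  power₂ u v uv (suc k) = ≈-trans
    (identity 4 (λ p u Q w → p :* :- (u :* (w :* Q :* Q)) :* :- (u :* (w :* Q :* Q :* Q)) :* :- (u :* (w :* Q :* Q :* Q :* Q))
       := p :* :- (u :* u :* u :* (w :* w :* w :* (Q :* Q :* Q :* (Q :* Q :* Q) :* (Q :* Q :* Q))))) refl (power u Q (2 + k * 3)) u Q (Q ↑ (k * 3)))
    (≈-trans (·-cong (power₂ u v uv k) (⊖-cong (·-congˡ (cube u) (·-congʳ Q₉ (≈-sym (Q₉↑ k)))))) (·-assoc _ _ _))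

  -- The indices from -(3n + 1) to 3n + 1 contain exactly 2n + 1 of each class modulo 3. The classes
  -- of 0, 1 and -1 are centred at the terms 1, -u and -v, and all three are cut at the same n.
  theta-dissection : ∀ u v → u · v ≈ Q → ∀ n → theta u v Q (1 + n * 3)
    ≈ theta (cube (u · Q)) (cube (v · Q)) Q₉ n
      ⊕ ⊖ u · theta (cube (u · Q · Q)) (cube v) Q₉ n
      ⊕ ⊖ v · theta (cube (v · Q · Q)) (cube u) Q₉ n
  theta-dissection u v uv zero =
    identity 2 (λ u v → let 𝟙 = con (+ 1) in 𝟙 :+ (𝟙 :* :- (u :* 𝟙) :+ 𝟙 :* :- (v :* 𝟙)) := 𝟙 :+ :- u :* 𝟙 :+ :- v :* 𝟙) refl u v
  theta-dissection u v uv (suc n) = ≈-trans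
    (⊕-cong (⊕-cong (⊕-cong (theta-dissection u v uv n)
      (⊕-cong (power₂ u v uv n) (power₂ v u (≈-trans (·-comm v u) uv) n)))
      (⊕-cong (power₀ u (suc n)) (power₀ v (suc n))))
      (⊕-cong (power₁ u (suc n)) (power₁ v (suc n))))
    (identity 11 (λ u v a b c d e f g h i → a :+ :- u :* b :+ :- v :* c :+ (:- v :* d :+ :- u :* e) :+ (f :+ g) :+ (:- u :* h :+ :- v :* i)
      := a :+ (f :+ g) :+ :- u :* (b :+ (h :+ e)) :+ :- v :* (c :+ (i :+ d))) refl u v _ _ _
      (power (cube u) Q₉ (suc n)) (power (cube v) Q₉ (suc n)) (power (cube (u · Q)) Q₉ (suc n)) (power (cube (v · Q)) Q₉ (suc n))
      (power (cube (u · Q · Q)) Q₉ (suc n)) (power (cube (v · Q · Q)) Q₉ (suc n)))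

  triple-dissection : ∀ u v → u · v ≈ Q → Q ≈[ 1 ] zeroS → triple u v Q
    ≈ triple (cube (u · Q)) (cube (v · Q)) Q₉
      ⊕ ⊖ u · triple (cube (u · Q · Q)) (cube v) Q₉
      ⊕ ⊖ v · triple (cube (v · Q · Q)) (cube u) Q₉
  triple-dissection u v uv Q0 = []⇒≈ λ K → []-trans
    (jacobi u v Q uv Q0 {K} (ℕₚ.≤-trans (ℕₚ.m≤m*n (K + K) 3) (ℕₚ.n≤1+n _)))
    ([]-trans (≈⇒[] (theta-dissection u v uv (K + K)))
      ([]-sym (⊕-cong[] (⊕-cong[] (jacobi _ _ Q₉ centre Q₉-order ℕₚ.≤-refl)
        (·-cong[] []-refl (jacobi _ _ Q₉ (side u v uv) Q₉-order ℕₚ.≤-refl)))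
        (·-cong[] []-refl (jacobi _ _ Q₉ (side v u (≈-trans (·-comm v u) uv)) Q₉-order ℕₚ.≤-refl)))))
    where
    Q₉-order : Q₉ ≈[ 1 ] zeroS
    Q₉-order = cube-order (cube-order Q0)
    centre : cube (u · Q) · cube (v · Q) ≈ Q₉
    centre = ≈-trans (identity 3 (λ u v Q → let a = u :* Q ; b = v :* Q ; c = u :* v :* Q :* Q in
      a :* a :* a :* (b :* b :* b) := c :* c :* c) refl u v Q) (cube-cong (·-congʳ Q (·-congʳ Q uv)))
    side : ∀ u v → u · v ≈ Q → cube (u · Q · Q) · cube v ≈ Q₉
    side u v uv = ≈-trans (identity 3 (λ u v Q → let a = u :* Q :* Q ; c = u :* v :* Q :* Q in
      a :* a :* a :* (v :* v :* v) := c :* c :* c) refl u v Q) (cube-cong (·-congʳ Q (·-congʳ Q uv)))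

-- Splitting infinite products; Euler's identity

prod-head : ∀ x Q n → prod x Q (suc n) ≈ oneMinus x · prod (x · Q) Q n
prod-head x Q zero    = identity 1 (λ x → con (+ 1) :* (con (+ 1) :- x :* con (+ 1)) := (con (+ 1) :- x) :* con (+ 1)) refl x
prod-head x Q (suc n) = ≈-trans (·-congʳ (oneMinus (x · Q ↑ suc n)) (prod-head x Q n))
  (identity 4 (λ y Q w p → (con (+ 1) :- y) :* p :* (con (+ 1) :- y :* (w :* Q)) := (con (+ 1) :- y) :* (p :* (con (+ 1) :- y :* Q :* w))) refl
    x Q (Q ↑ n) (prod (x · Q) Q n))

prod∞-head : ∀ x Q → Q ≈[ 1 ] zeroS → prod∞ x Q ≈ oneMinus x · prod∞ (x · Q) Q
prod∞-head x Q Q0 = []⇒≈ λ K → []-trans (prod∞-approx x Q Q0 (ℕₚ.n≤1+n K)) ([]-trans (≈⇒[] (prod-head x Q K))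
  (·-cong[] []-refl ([]-sym (prod∞-approx (x · Q) Q Q0 ℕₚ.≤-refl))))

prod-even-odd : ∀ x Q n → prod x Q (n * 2) ≈ prod x (Q · Q) n · prod (x · Q) (Q · Q) n
prod-even-odd x Q zero    = ≈-sym (·-identityˡ oneS)
prod-even-odd x Q (suc n) = begin
  prod x Q (n * 2) · oneMinus (x · Q ↑ (n * 2)) · oneMinus (x · (Q ↑ (n * 2) · Q))
    ≈⟨ ·-cong (·-cong (prod-even-odd x Q n) (oneMinus-cong (·-congˡ x w≈))) (oneMinus-cong (·-congˡ x (·-congʳ Q w≈))) ⟩
  L · R · oneMinus (x · w) · oneMinus (x · (w · Q))
    ≈⟨ identity 5 (λ l r x w Q → let 𝟙 = con (+ 1) in l :* r :* (𝟙 :- x :* w) :* (𝟙 :- x :* (w :* Q)) := l :* (𝟙 :- x :* w) :* (r :* (𝟙 :- x :* Q :* w))) refl L R x w Q ⟩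
  L · oneMinus (x · w) · (R · oneMinus (x · Q · w)) ∎
  where
  open ≈-Reasoning
  w = (Q · Q) ↑ n
  L = prod x (Q · Q) n
  R = prod (x · Q) (Q · Q) n
  w≈ : Q ↑ (n * 2) ≈ w
  w≈ = ≈-trans (↑-* Q n 2) (↑-cong n (·-congʳ Q (·-identityˡ Q)))

square-order : ∀ {Q} → Q ≈[ 1 ] zeroS → Q · Q ≈[ 1 ] zeroS
square-order {Q} Q0 = ·-order {Q} {Q} 0 1 (mk[] λ _ ()) Q0

prod∞-even-odd : ∀ x Q → Q ≈[ 1 ] zeroS → prod∞ x Q ≈ prod∞ x (Q · Q) · prod∞ (x · Q) (Q · Q)
prod∞-even-odd x Q Q0 = []⇒≈ λ K → []-trans (prod∞-approx x Q Q0 (ℕₚ.m≤m*n K 2)) ([]-trans (≈⇒[] (prod-even-odd x Q K))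
  ([]-sym (·-cong[] (prod∞-approx x (Q · Q) (square-order Q0) ℕₚ.≤-refl) (prod∞-approx (x · Q) (Q · Q) (square-order Q0) ℕₚ.≤-refl))))

prod-mod3 : ∀ x Q n → prod x Q (n * 3) ≈ prod x (cube Q) n · prod (x · Q) (cube Q) n · prod (x · Q · Q) (cube Q) n
prod-mod3 x Q zero    = identity 0 (con (+ 1) := con (+ 1) :* con (+ 1) :* con (+ 1)) refl
prod-mod3 x Q (suc n) = begin
  prod x Q (n * 3) · oneMinus (x · v) · oneMinus (x · (v · Q)) · oneMinus (x · (v · Q · Q))
    ≈⟨ ·-cong (·-cong (·-cong (prod-mod3 x Q n) (oneMinus-cong (·-congˡ x w≈))) (oneMinus-cong (·-congˡ x (·-congʳ Q w≈))))
         (oneMinus-cong (·-congˡ x (·-congʳ Q (·-congʳ Q w≈)))) ⟩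
  L · M · R · oneMinus (x · w) · oneMinus (x · (w · Q)) · oneMinus (x · (w · Q · Q))
    ≈⟨ identity 6 (λ l m r x w Q → let 𝟙 = con (+ 1) in
         l :* m :* r :* (𝟙 :- x :* w) :* (𝟙 :- x :* (w :* Q)) :* (𝟙 :- x :* (w :* Q :* Q))
         := l :* (𝟙 :- x :* w) :* (m :* (𝟙 :- x :* Q :* w)) :* (r :* (𝟙 :- x :* Q :* Q :* w))) refl L M R x w Q ⟩
  L · oneMinus (x · w) · (M · oneMinus (x · Q · w)) · (R · oneMinus (x · Q · Q · w)) ∎
  where
  open ≈-Reasoning
  v = Q ↑ (n * 3)
  w = cube Q ↑ n
  L = prod x (cube Q) n
  M = prod (x · Q) (cube Q) n
  R = prod (x · Q · Q) (cube Q) n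
  w≈ : v ≈ w
  w≈ = ≈-trans (↑-* Q n 3) (↑-cong n (·-congʳ Q (·-congʳ Q (·-identityˡ Q))))

prod∞-mod3 : ∀ x Q → Q ≈[ 1 ] zeroS → prod∞ x Q ≈ prod∞ x (cube Q) · prod∞ (x · Q) (cube Q) · prod∞ (x · Q · Q) (cube Q)
prod∞-mod3 x Q Q0 = []⇒≈ λ K → []-trans (prod∞-approx x Q Q0 (ℕₚ.m≤m*n K 3)) ([]-trans (≈⇒[] (prod-mod3 x Q K))
  ([]-sym (·-cong[] (·-cong[] (prod∞-approx x (cube Q) (cube-order Q0) ℕₚ.≤-refl) (prod∞-approx (x · Q) (cube Q) (cube-order Q0) ℕₚ.≤-refl))
    (prod∞-approx (x · Q · Q) (cube Q) (cube-order Q0) ℕₚ.≤-refl))))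

prod-square : ∀ x Q n → prod x Q n · prod (⊖ x) Q n ≈ prod (x · x) (Q · Q) n
prod-square x Q zero    = ·-identityˡ oneS
prod-square x Q (suc n) = ≈-trans
  (identity 4 (λ p r x w → let 𝟙 = con (+ 1) in p :* (𝟙 :- x :* w) :* (r :* (𝟙 :- :- x :* w)) := p :* r :* (𝟙 :- x :* x :* (w :* w))) refl
    (prod x Q n) (prod (⊖ x) Q n) x (Q ↑ n))
  (·-cong (prod-square x Q n) (oneMinus-cong (·-congˡ (x · x) (≈-sym (·-↑ Q Q n)))))

prod∞-square : ∀ x Q → Q ≈[ 1 ] zeroS → prod∞ x Q · prod∞ (⊖ x) Q ≈ prod∞ (x · x) (Q · Q)
prod∞-square x Q Q0 = []⇒≈ λ K → []-trans (·-cong[] (prod∞-approx x Q Q0 ℕₚ.≤-refl) (prod∞-approx (⊖ x) Q Q0 ℕₚ.≤-refl))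
  ([]-trans (≈⇒[] (prod-square x Q K)) ([]-sym (prod∞-approx (x · x) (Q · Q) (square-order Q0) ℕₚ.≤-refl)))

odd : ℕ → Series
odd d = prod∞ (X ↑ d) (X ↑ (d * 2))

plus : ℕ → Series
plus d = prod∞ (⊖ (X ↑ d)) (X ↑ d)

X↑-square : ∀ d → X ↑ d · X ↑ d ≈ X ↑ (d * 2)
X↑-square d = ≈-trans (≈-sym (↑-+ X d d)) (SR.reflexive (cong (X ↑_) (trans (cong (λ m → d + m) (sym (ℕₚ.+-identityʳ d))) (ℕₚ.*-comm 2 d))))

odd·E : ∀ d → odd (suc d) · E (suc d * 2) ≈ E (suc d)
odd·E d = ≈-sym (≈-trans (prod∞-even-odd (X ↑ suc d) (X ↑ suc d) (X↑-order d))
  (·-cong (prod∞-cong ≈-refl (X↑-square (suc d))) (prod∞-cong (X↑-square (suc d)) (X↑-square (suc d)))))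

E·plus : ∀ d → E (suc d) · plus (suc d) ≈ E (suc d * 2)
E·plus d = ≈-trans (prod∞-square (X ↑ suc d) (X ↑ suc d) (X↑-order d)) (prod∞-cong (X↑-square (suc d)) (X↑-square (suc d)))

-- Euler's theorem on partitions into odd and into distinct parts: the two products are E_d / E_{2d}
-- and E_{2d} / E_d.
odd·plus : ∀ d → odd (suc d) · plus (suc d) ≈ oneS
odd·plus d = ·-cancelʳ (E (suc d * 2)) (E-Inv (suc (d * 2))) (begin
  odd (suc d) · plus (suc d) · E (suc d * 2)     ≈⟨ identity 3 (λ a b c → a :* b :* c := a :* c :* b) refl (odd (suc d)) (plus (suc d)) (E (suc d * 2)) ⟩
  odd (suc d) · E (suc d * 2) · plus (suc d)     ≈⟨ ·-congʳ (plus (suc d)) (odd·E d) ⟩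
  E (suc d) · plus (suc d)                        ≈⟨ E·plus d ⟩
  E (suc d * 2)                                  ≈⟨ ·-identityˡ (E (suc d * 2)) ⟨
  oneS · E (suc d * 2)                           ∎)
  where open ≈-Reasoning

infixl 9 _↑ₚ_
_↑ₚ_ : ∀ {n} → Polynomial n → ℕ → Polynomial n
p ↑ₚ zero  = con (+ 1)
p ↑ₚ suc n = p ↑ₚ n :* p

-- φ(-q), 2ψ(q), and the theta functions occurring in their 3-dissections.
φ ψ Ω A : Series
φ = triple (X ↑ 1) (X ↑ 1) (X ↑ 2)
ψ = triple (⊖ oneS) (⊖ (X ↑ 1)) (X ↑ 1)
Ω = triple (X ↑ 5) (X ↑ 1) (X ↑ 6)
A = triple (⊖ (X ↑ 1)) (⊖ (X ↑ 2)) (X ↑ 3)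

-- The product forms are φ(-q) = E_1² / E_2 and ψ(q) = E_2² / E_1; multiplying by E_1 E_2 avoids the
-- denominators. The doubling is the leading factor 1 - (-1) of the product at x = -1.
φ·ψ : φ · ψ ≈ E 1 · E 2 ⊕ E 1 · E 2
φ·ψ = ·-cancelʳ (E 1 · E 2) (·-Inv (E-Inv 0) (E-Inv 1)) (begin
  φ · ψ · (E 1 · E 2)
    ≈⟨ ·-congʳ (E 1 · E 2) (·-congˡ φ (·-congʳ (E 1) (·-congʳ (plus 1) head))) ⟩
  odd 1 · odd 1 · E 2 · ((oneS ⊕ oneS) · plus 1 · plus 1 · E 1) · (E 1 · E 2)
    ≈⟨ identity 4 (λ o e p f → let 𝟙 = con (+ 1) in o :* o :* e :* ((𝟙 :+ 𝟙) :* p :* p :* f) :* (f :* e)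
         := (𝟙 :+ 𝟙) :* ((o :* e) :* (o :* e) :* ((f :* p) :* (f :* p)))) refl (odd 1) (E 2) (plus 1) (E 1) ⟩
  (oneS ⊕ oneS) · ((odd 1 · E 2) · (odd 1 · E 2) · ((E 1 · plus 1) · (E 1 · plus 1)))
    ≈⟨ ·-congˡ (oneS ⊕ oneS) (·-cong (·-cong (odd·E 0) (odd·E 0)) (·-cong (E·plus 0) (E·plus 0))) ⟩
  (oneS ⊕ oneS) · (E 1 · E 1 · (E 2 · E 2))
    ≈⟨ identity 2 (λ e f → let 𝟙 = con (+ 1) in (𝟙 :+ 𝟙) :* (e :* e :* (f :* f)) := (e :* f :+ e :* f) :* (e :* f)) refl (E 1) (E 2) ⟩
  (E 1 · E 2 ⊕ E 1 · E 2) · (E 1 · E 2) ∎)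
  where
  open ≈-Reasoning
  head : prod∞ (⊖ oneS) (X ↑ 1) ≈ (oneS ⊕ oneS) · plus 1
  head = ≈-trans (prod∞-head (⊖ oneS) (X ↑ 1) (X↑-order 0)) (·-cong
    (identity 0 (let 𝟙 = con (+ 1) in 𝟙 :- :- 𝟙 := 𝟙 :+ 𝟙) refl)
    (prod∞-cong (identity 1 (λ x → :- con (+ 1) :* x := :- x) refl (X ↑ 1)) ≈-refl))

-- Without their Euler factors, Ω and A consist of the factors of `odd 1` and `plus 1` whose
-- exponents are prime to 3. The missing ones form `odd 3` and `plus 3`, and Euler's identity for d
-- = 1 and d = 3 reduces everything to 1.
Ω·A : Ω · A ≈ E 3 · E 6
Ω·A = begin
  Ω · A
    ≈⟨ ≈-trans (≈-sym (·-identityʳ (Ω · A))) (·-congˡ (Ω · A) (≈-sym (odd·plus 2))) ⟩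
  Ω · A · (odd 3 · plus 3)
    ≈⟨ identity 8 (λ a b e c d f o p → a :* b :* e :* (c :* d :* f) :* (o :* p) := b :* o :* a :* (c :* d :* p) :* (f :* e)) refl
         (prod∞ (X ↑ 5) (X ↑ 6)) (prod∞ (X ↑ 1) (X ↑ 6)) (E 6) (prod∞ (⊖ (X ↑ 1)) (X ↑ 3)) (prod∞ (⊖ (X ↑ 2)) (X ↑ 3)) (E 3) (odd 3) (plus 3) ⟩
  prod∞ (X ↑ 1) (X ↑ 6) · odd 3 · prod∞ (X ↑ 5) (X ↑ 6) · (prod∞ (⊖ (X ↑ 1)) (X ↑ 3) · prod∞ (⊖ (X ↑ 2)) (X ↑ 3) · plus 3) · (E 3 · E 6)
    ≈⟨ ·-congʳ (E 3 · E 6) (·-cong odd-mod3 plus-mod3) ⟨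
  odd 1 · plus 1 · (E 3 · E 6)
    ≈⟨ ≈-trans (·-congʳ (E 3 · E 6) (odd·plus 0)) (·-identityˡ (E 3 · E 6)) ⟩
  E 3 · E 6 ∎
  where
  open ≈-Reasoning
  Q₆ : cube (X ↑ 2) ≈ X ↑ 6
  Q₆ = identity 1 (λ x → let y = x ↑ₚ 2 in y :* y :* y := x ↑ₚ 6) refl X
  Q₃ : cube (X ↑ 1) ≈ X ↑ 3
  Q₃ = identity 1 (λ x → let y = x ↑ₚ 1 in y :* y :* y := x ↑ₚ 3) refl X
  odd-mod3 : odd 1 ≈ prod∞ (X ↑ 1) (X ↑ 6) · odd 3 · prod∞ (X ↑ 5) (X ↑ 6)
  odd-mod3 = ≈-trans (prod∞-mod3 (X ↑ 1) (X ↑ 2) (X↑-order 1)) (·-cong (·-cong (prod∞-cong ≈-refl Q₆)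
    (prod∞-cong (identity 1 (λ x → x ↑ₚ 1 :* x ↑ₚ 2 := x ↑ₚ 3) refl X) Q₆))
    (prod∞-cong (identity 1 (λ x → x ↑ₚ 1 :* x ↑ₚ 2 :* x ↑ₚ 2 := x ↑ₚ 5) refl X) Q₆))
  plus-mod3 : plus 1 ≈ prod∞ (⊖ (X ↑ 1)) (X ↑ 3) · prod∞ (⊖ (X ↑ 2)) (X ↑ 3) · plus 3
  plus-mod3 = ≈-trans (prod∞-mod3 (⊖ (X ↑ 1)) (X ↑ 1) (X↑-order 0)) (·-cong (·-cong (prod∞-cong ≈-refl Q₃)
    (prod∞-cong (identity 1 (λ x → :- (x ↑ₚ 1) :* x ↑ₚ 1 := :- (x ↑ₚ 2)) refl X) Q₃))
    (prod∞-cong (identity 1 (λ x → :- (x ↑ₚ 1) :* x ↑ₚ 1 :* x ↑ₚ 1 := :- (x ↑ₚ 3)) refl X) Q₃))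

TT-X↑ : ∀ m → T (T (X ↑ m)) ≈ X ↑ (m * 3 * 3)
TT-X↑ m = ≈-trans (T-cong (T-X↑ m)) (T-X↑ (m * 3))

T-⊖X↑ : ∀ m → T (⊖ (X ↑ m)) ≈ ⊖ (X ↑ (m * 3))
T-⊖X↑ m = ≈-trans (T-⊖ (X ↑ m)) (⊖-cong (T-X↑ m))

TT-triple : ∀ u v Q → Q ≈[ 1 ] zeroS → T (T (triple u v Q)) ≈ triple (T (T u)) (T (T v)) (T (T Q))
TT-triple u v Q Q0 = ≈-trans (T-cong (T-triple u v Q Q0)) (T-triple (T u) (T v) (T Q) (T-order Q0))

-- Because u = v = q, the classes of 1 and -1 give the same series, hence the coefficient -2; the
-- parameters (q³)³ and q¹⁸ of the central class are those of φ(-q⁹).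
φ-dissection : φ ≈ T (T φ) ⊕ X · T (⊖ (Ω ⊕ Ω))
φ-dissection = begin
  φ
    ≈⟨ triple-dissection (X ↑ 1) (X ↑ 1) (identity 1 (λ x → x ↑ₚ 1 :* x ↑ₚ 1 := x ↑ₚ 2) refl X) (X↑-order 1) ⟩
  triple (cube (X ↑ 1 · X ↑ 2)) (cube (X ↑ 1 · X ↑ 2)) Q₉
    ⊕ ⊖ (X ↑ 1) · triple (cube (X ↑ 1 · X ↑ 2 · X ↑ 2)) (cube (X ↑ 1)) Q₉
    ⊕ ⊖ (X ↑ 1) · triple (cube (X ↑ 1 · X ↑ 2 · X ↑ 2)) (cube (X ↑ 1)) Q₉
    ≈⟨ ⊕-cong (⊕-cong (triple-cong centre centre (≈-trans Q₁₈ (≈-sym (TT-X↑ 2)))) (·-congˡ (⊖ (X ↑ 1)) side)) (·-congˡ (⊖ (X ↑ 1)) side) ⟩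
  triple (T (T (X ↑ 1))) (T (T (X ↑ 1))) (T (T (X ↑ 2))) ⊕ ⊖ (X ↑ 1) · T Ω ⊕ ⊖ (X ↑ 1) · T Ω
    ≈⟨ ⊕-congʳ _ (⊕-congʳ _ (TT-triple (X ↑ 1) (X ↑ 1) (X ↑ 2) (X↑-order 1))) ⟨
  T (T φ) ⊕ ⊖ (X ↑ 1) · T Ω ⊕ ⊖ (X ↑ 1) · T Ω
    ≈⟨ identity 3 (λ x a b → a :+ :- (x ↑ₚ 1) :* b :+ :- (x ↑ₚ 1) :* b := a :+ x :* :- (b :+ b)) refl X (T (T φ)) (T Ω) ⟩
  T (T φ) ⊕ X · ⊖ (T Ω ⊕ T Ω)
    ≈⟨ ⊕-congˡ (T (T φ)) (·-congˡ X (≈-trans (T-⊖ (Ω ⊕ Ω)) (⊖-cong (T-⊕ Ω Ω)))) ⟨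
  T (T φ) ⊕ X · T (⊖ (Ω ⊕ Ω)) ∎
  where
  open ≈-Reasoning
  open ThetaDissection (X ↑ 2)
  Q₁₈ : Q₉ ≈ X ↑ 18
  Q₁₈ = identity 1 (λ x → let y = x ↑ₚ 2 ; z = y :* y :* y in z :* z :* z := x ↑ₚ 18) refl X
  centre : cube (X ↑ 1 · X ↑ 2) ≈ T (T (X ↑ 1))
  centre = ≈-trans (identity 1 (λ x → let y = x ↑ₚ 1 :* x ↑ₚ 2 in y :* y :* y := x ↑ₚ 9) refl X) (≈-sym (TT-X↑ 1))
  side : triple (cube (X ↑ 1 · X ↑ 2 · X ↑ 2)) (cube (X ↑ 1)) Q₉ ≈ T Ω
  side = ≈-sym (≈-trans (T-triple (X ↑ 5) (X ↑ 1) (X ↑ 6) (X↑-order 5)) (triple-cong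
    (≈-trans (T-X↑ 5) (identity 1 (λ x → let y = x ↑ₚ 1 :* x ↑ₚ 2 :* x ↑ₚ 2 in x ↑ₚ 15 := y :* y :* y) refl X))
    (≈-trans (T-X↑ 1) (identity 1 (λ x → let y = x ↑ₚ 1 in x ↑ₚ 3 := y :* y :* y) refl X))
    (≈-trans (T-X↑ 6) (≈-sym Q₁₈))))

-- For u = -1 and v = -q the central class and the class centred at -u = 1 agree after exchange of
-- the two parameters, which gives A twice; the class centred at -v = q reproduces the series at q⁹.
ψ-dissection : ψ ≈ T (A ⊕ A) ⊕ X · T (T ψ)
ψ-dissection = begin
  ψ
    ≈⟨ triple-dissection (⊖ oneS) (⊖ (X ↑ 1)) (identity 1 (λ x → :- con (+ 1) :* :- (x ↑ₚ 1) := x ↑ₚ 1) refl X) (X↑-order 0) ⟩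
  triple (cube (⊖ oneS · X ↑ 1)) (cube (⊖ (X ↑ 1) · X ↑ 1)) Q₉
    ⊕ ⊖ (⊖ oneS) · triple (cube (⊖ oneS · X ↑ 1 · X ↑ 1)) (cube (⊖ (X ↑ 1))) Q₉
    ⊕ ⊖ (⊖ (X ↑ 1)) · triple (cube (⊖ (X ↑ 1) · X ↑ 1 · X ↑ 1)) (cube (⊖ oneS)) Q₉
    ≈⟨ ⊕-cong (⊕-cong (≈-sym (≈-trans TA (triple-cong
           (identity 1 (λ x → let y = :- con (+ 1) :* x ↑ₚ 1 in :- (x ↑ₚ 3) := y :* y :* y) refl X)
           (identity 1 (λ x → let y = :- (x ↑ₚ 1) :* x ↑ₚ 1 in :- (x ↑ₚ 6) := y :* y :* y) refl X) (≈-sym Q₉≈))))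
         (·-congˡ (⊖ (⊖ oneS)) (≈-sym (≈-trans TA (≈-trans (triple-comm _ _ _) (triple-cong
           (identity 1 (λ x → let y = :- con (+ 1) :* x ↑ₚ 1 :* x ↑ₚ 1 in :- (x ↑ₚ 6) := y :* y :* y) refl X)
           (identity 1 (λ x → let y = :- (x ↑ₚ 1) in :- (x ↑ₚ 3) := y :* y :* y) refl X) (≈-sym Q₉≈)))))))
         (·-congˡ (⊖ (⊖ (X ↑ 1))) (≈-sym (≈-trans TTψ (≈-trans (triple-comm _ _ _) (triple-cong
           (identity 1 (λ x → let y = :- (x ↑ₚ 1) :* x ↑ₚ 1 :* x ↑ₚ 1 in :- (x ↑ₚ 9) := y :* y :* y) refl X)
           (identity 0 (let y = :- con (+ 1) in y := y :* y :* y) refl) (≈-sym Q₉≈)))))) ⟩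
  T A ⊕ ⊖ (⊖ oneS) · T A ⊕ ⊖ (⊖ (X ↑ 1)) · T (T ψ)
    ≈⟨ identity 3 (λ x a b → a :+ :- (:- con (+ 1)) :* a :+ :- (:- (x ↑ₚ 1)) :* b := a :+ a :+ x :* b) refl X (T A) (T (T ψ)) ⟩
  T A ⊕ T A ⊕ X · T (T ψ)
    ≈⟨ ⊕-congʳ (X · T (T ψ)) (T-⊕ A A) ⟨
  T (A ⊕ A) ⊕ X · T (T ψ) ∎
  where
  open ≈-Reasoning
  open ThetaDissection (X ↑ 1)
  Q₉≈ : Q₉ ≈ X ↑ 9
  Q₉≈ = identity 1 (λ x → let y = x ↑ₚ 1 ; z = y :* y :* y in z :* z :* z := x ↑ₚ 9) refl X
  TA : T A ≈ triple (⊖ (X ↑ 3)) (⊖ (X ↑ 6)) (X ↑ 9)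
  TA = ≈-trans (T-triple (⊖ (X ↑ 1)) (⊖ (X ↑ 2)) (X ↑ 3) (X↑-order 2)) (triple-cong (T-⊖X↑ 1) (T-⊖X↑ 2) (T-X↑ 3))
  TTψ : T (T ψ) ≈ triple (⊖ oneS) (⊖ (X ↑ 9)) (X ↑ 9)
  TTψ = ≈-trans (TT-triple (⊖ oneS) (⊖ (X ↑ 1)) (X ↑ 1) (X↑-order 0)) (triple-cong
    (≈-trans (T-cong (≈-trans (T-⊖ oneS) (⊖-cong T-one))) (≈-trans (T-⊖ oneS) (⊖-cong T-one)))
    (≈-trans (T-cong (T-⊖X↑ 1)) (T-⊖X↑ 3)) (TT-X↑ 1))

-- The discriminant b² - a c of E_1 E_2

T-E : ∀ d → T (E (suc d)) ≈ E (suc d * 3)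
T-E d = ≈-trans (T-prod∞ (X ↑ suc d) (X ↑ suc d) (X↑-order d)) (prod∞-cong (T-X↑ (suc d)) (T-X↑ (suc d)))

opaque
  unfolding _⊕_

  U-⊕ : ∀ i f g → U i (f ⊕ g) ≈ U i f ⊕ U i g
  U-⊕ i f g = ≈-refl

  halve : ∀ {a b} → a ⊕ a ≈ b ⊕ b → a ≈ b
  halve p = mk≈ λ n → ℤₚ.*-cancelˡ-≡ (+ 2) _ _ (trans (double _) (trans (at p n) (sym (double _))))
    where
    double : ∀ i → + 2 *ℤ i ≡ i +ℤ i
    double i = ZS.solve 1 (λ i → ZS.con (+ 2) ZS.:* i ZS.:= i ZS.:+ i) refl i

-- With the doubled parts, s = 2e and t = -4e for e = E_3 E_6, so four times the discriminant is (4
-- - 8 + 16) e² = 12 e². This is the origin of the 3 in the theorem; the two uses of `halve` remove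
-- the 4, doubling being injective on integers.
E₁E₂-discriminant : let f = E 1 · E 2 in
  U 1 f · U 1 f ⊕ ⊖ (U 0 f · U 2 f) ≈ constS (+ 3) · (E 3 · E 6 · (E 3 · E 6))
E₁E₂-discriminant = halve (halve (begin
  D ⊕ D ⊕ (D ⊕ D)
    ≈⟨ identity 3 (λ a b c → let d = b :* b :- a :* c in d :+ d :+ (d :+ d) := (b :+ b) :* (b :+ b) :- (a :+ a) :* (c :+ c)) refl (U 0 f) (U 1 f) (U 2 f) ⟩
  (U 1 f ⊕ U 1 f) · (U 1 f ⊕ U 1 f) ⊕ ⊖ ((U 0 f ⊕ U 0 f) · (U 2 f ⊕ U 2 f))
    ≈⟨ ⊕-cong (·-cong f₁ f₁) (⊖-cong (·-cong f₀ f₂)) ⟩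
  (T φ · T ψ ⊕ φ₁ · ψ₀) · (T φ · T ψ ⊕ φ₁ · ψ₀) ⊕ ⊖ (T φ · ψ₀ · (φ₁ · T ψ))
    ≈⟨ identity 4 (λ a b c d → (a :* d :+ b :* c) :* (a :* d :+ b :* c) :- a :* c :* (b :* d)
         := a :* d :* (a :* d) :+ a :* d :* (b :* c) :+ b :* c :* (b :* c)) refl (T φ) φ₁ ψ₀ (T ψ) ⟩
  s · s ⊕ s · t ⊕ t · t
    ≈⟨ ⊕-cong (⊕-cong (·-cong s≈ s≈) (·-cong s≈ t≈)) (·-cong t≈ t≈) ⟩
  (e ⊕ e) · (e ⊕ e) ⊕ (e ⊕ e) · ⊖ (e ⊕ e ⊕ (e ⊕ e)) ⊕ ⊖ (e ⊕ e ⊕ (e ⊕ e)) · ⊖ (e ⊕ e ⊕ (e ⊕ e))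
    ≈⟨ identity 1 (λ e → let y = e :+ e ; z = :- (e :+ e :+ (e :+ e)) ; w = con (+ 3) :* (e :* e) in
         y :* y :+ y :* z :+ z :* z := w :+ w :+ (w :+ w)) refl e ⟩
  w ⊕ w ⊕ (w ⊕ w) ∎))
  where
  open ≈-Reasoning
  f = E 1 · E 2
  D = U 1 f · U 1 f ⊕ ⊖ (U 0 f · U 2 f)
  e = E 3 · E 6
  w = constS (+ 3) · (e · e)
  φ₁ = ⊖ (Ω ⊕ Ω)
  ψ₀ = A ⊕ A
  s = T φ · T ψ
  t = φ₁ · ψ₀
  s≈ : s ≈ e ⊕ e
  s≈ = ≈-trans (≈-sym (T-· φ ψ)) (≈-trans (T-cong φ·ψ) (≈-trans (T-⊕ f f) (⊕-cong Tf Tf)))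
    where
    Tf : T f ≈ e
    Tf = ≈-trans (T-· (E 1) (E 2)) (·-cong (T-E 0) (T-E 1))
  t≈ : t ≈ ⊖ (e ⊕ e ⊕ (e ⊕ e))
  t≈ = ≈-trans (identity 2 (λ o a → :- (o :+ o) :* (a :+ a) := let y = o :* a in :- (y :+ y :+ (y :+ y))) refl Ω A)
    (⊖-cong (⊕-cong (⊕-cong Ω·A Ω·A) (⊕-cong Ω·A Ω·A)))
  parts : f ⊕ f ≈ dissected (T φ · ψ₀) (T φ · T ψ ⊕ φ₁ · ψ₀) (φ₁ · T ψ)
  parts = begin
    f ⊕ f
      ≈⟨ φ·ψ ⟨
    φ · ψ
      ≈⟨ ·-cong φ-dissection ψ-dissection ⟩
    (T (T φ) ⊕ X · T φ₁) · (T ψ₀ ⊕ X · T (T ψ))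
      ≈⟨ identity 5 (λ x a b c d → (a :+ x :* b) :* (c :+ x :* d) := a :* c :+ x :* (a :* d :+ b :* c) :+ x :* x :* (b :* d)) refl
           X (T (T φ)) (T φ₁) (T ψ₀) (T (T ψ)) ⟩
    T (T φ) · T ψ₀ ⊕ X · (T (T φ) · T (T ψ) ⊕ T φ₁ · T ψ₀) ⊕ X · X · (T φ₁ · T (T ψ))
      ≈⟨ ⊕-cong (⊕-cong (T-· (T φ) ψ₀) (·-congˡ X (≈-trans (T-⊕ (T φ · T ψ) (φ₁ · ψ₀)) (⊕-cong (T-· (T φ) (T ψ)) (T-· φ₁ ψ₀)))))
           (·-congˡ (X · X) (T-· φ₁ (T ψ))) ⟨
    dissected (T φ · ψ₀) (T φ · T ψ ⊕ φ₁ · ψ₀) (φ₁ · T ψ) ∎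
  f₀ : U 0 f ⊕ U 0 f ≈ T φ · ψ₀
  f₀ = ≈-trans (≈-sym (U-⊕ 0 f f)) (U-dissected₀ parts)
  f₁ : U 1 f ⊕ U 1 f ≈ T φ · T ψ ⊕ φ₁ · ψ₀
  f₁ = ≈-trans (≈-sym (U-⊕ 1 f f)) (U-dissected₁ parts)
  f₂ : U 2 f ⊕ U 2 f ≈ φ₁ · T ψ
  f₂ = ≈-trans (≈-sym (U-⊕ 2 f f)) (U-dissected₂ parts)

-- The generating function of PD

X↑-·-≤ : ∀ e n a → e ≤ n → (X ↑ e · a) n ≡ a (n ∸ e)
X↑-·-≤ zero    n       a h       = at (·-identityˡ a) n
X↑-·-≤ (suc e) (suc n) a (s≤s h) = trans
  (at (identity 3 (λ p x a → p :* x :* a := x :* (p :* a)) refl (X ↑ e) X a) (suc n))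
  (trans (X-·-suc (X ↑ e · a) n) (X↑-·-≤ e n a h))

X↑-·-> : ∀ e n a → n < e → (X ↑ e · a) n ≡ + 0
X↑-·-> e n a h = at[] ([]-weaken (ℕₚ.≤-reflexive (sym (ℕₚ.+-identityʳ e))) (·-order {X ↑ e} {a} e 0
  (↑-order e (mk[] λ { zero _ → refl ; (suc _) (s≤s ()) })) (mk[] λ _ ()))) n h

layer : ℕ → Series
layer k n = + PDle n k

-- Counts the objects whose parts are at most k + 1 and in which the size k + 1 occurs at most b
-- times.
partialLayer : ℕ → ℕ → Series
partialLayer k b n = + PDsum n (suc k) k b

layer-suc : ∀ k n → PDle n (suc k) ≡ PDsum n (suc k) k n
layer-suc k zero    = refl
layer-suc k (suc n) = refl

opaque
  unfolding _·_

  partialLayer-suc : ∀ k b → partialLayer k (suc b) ≈ partialLayer k b ⊕ constS (+ suc b) · (X ↑ (suc b * suc k) · layer k)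
  partialLayer-suc k b = mk≈ go
    where
    go : ∀ n → + PDsum n (suc k) k (suc b) ≡ + PDsum n (suc k) k b +ℤ (constS (+ suc b) · (X ↑ (suc b * suc k) · layer k)) n
    go n with suc b * suc k ℕₚ.≤? n
    ... | yes le = begin
      + (suc b * PDle (n ∸ suc b * suc k) k + PDsum n (suc k) k b)
        ≡⟨ ℤₚ.pos-+ (suc b * PDle (n ∸ suc b * suc k) k) (PDsum n (suc k) k b) ⟩
      + (suc b * PDle (n ∸ suc b * suc k) k) +ℤ + PDsum n (suc k) k b
        ≡⟨ ℤₚ.+-comm (+ (suc b * PDle (n ∸ suc b * suc k) k)) (+ PDsum n (suc k) k b) ⟩
      + PDsum n (suc k) k b +ℤ + (suc b * PDle (n ∸ suc b * suc k) k)
        ≡⟨ cong (+ PDsum n (suc k) k b +ℤ_) (begin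
             + (suc b * PDle (n ∸ suc b * suc k) k)           ≡⟨ ℤₚ.pos-* (suc b) _ ⟩
             + suc b *ℤ layer k (n ∸ suc b * suc k)            ≡⟨ cong (+ suc b *ℤ_) (X↑-·-≤ (suc b * suc k) n (layer k) le) ⟨
             + suc b *ℤ (X ↑ (suc b * suc k) · layer k) n       ≡⟨ constS-· (+ suc b) (X ↑ (suc b * suc k) · layer k) n ⟨
             (constS (+ suc b) · (X ↑ (suc b * suc k) · layer k)) n ∎) ⟩
      + PDsum n (suc k) k b +ℤ (constS (+ suc b) · (X ↑ (suc b * suc k) · layer k)) n ∎
      where open ≡-Reasoning
    ... | no ≰ = sym (trans (cong (+ PDsum n (suc k) k b +ℤ_) (trans (constS-· (+ suc b) (X ↑ (suc b * suc k) · layer k) n)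
      (trans (cong (+ suc b *ℤ_) (X↑-·-> (suc b * suc k) n (layer k) (ℕₚ.≰⇒> ≰))) (ℤₚ.*-zeroʳ (+ suc b))))) (ℤₚ.+-identityʳ (+ PDsum n (suc k) k b)))

-- The bracket is (1 - y)² times the truncated sum 1 + y + 2y² + ... + b y^b; its last two terms are
-- the error of the truncation.
partialLayer-closed : ∀ k b → let y = X ↑ suc k ; c = constS (+ b) in
  partialLayer k b · (oneMinus y · oneMinus y)
    ≈ layer k · (oneS ⊕ ⊖ y ⊕ y · y ⊕ ⊖ ((oneS ⊕ c) · (y ↑ b · y)) ⊕ c · (y ↑ b · y) · y)
partialLayer-closed k zero = ≈-trans
  (identity 2 (λ g y → let 𝟙 = con (+ 1) ; c = con (+ 0) in g :* ((𝟙 :- y) :* (𝟙 :- y))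
    := g :* (𝟙 :- y :+ y :* y :- (𝟙 :+ c) :* (𝟙 :* y) :+ c :* (𝟙 :* y) :* y)) refl (layer k) y)
  (·-congˡ (layer k) (⊕-cong (⊕-congˡ _ (⊖-cong (·-congʳ (oneS · y) (⊕-congˡ oneS c≈)))) (·-congʳ y (·-congʳ (oneS · y) c≈))))
  where
  y = X ↑ suc k
  c≈ : zeroS ≈ constS (+ 0)
  c≈ = embed≈constS (+ 0)
partialLayer-closed k (suc b) = begin
  partialLayer k (suc b) · (oneMinus y · oneMinus y)
    ≈⟨ ·-congʳ (oneMinus y · oneMinus y) (≈-trans (partialLayer-suc k b) (⊕-congˡ (partialLayer k b) (·-cong c′≈ (·-congʳ g (↑-* X (suc b) (suc k)))))) ⟩
  (partialLayer k b ⊕ (oneS ⊕ c) · (y ↑ b · y · g)) · (oneMinus y · oneMinus y)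
    ≈⟨ SR.distribʳ (oneMinus y · oneMinus y) (partialLayer k b) ((oneS ⊕ c) · (y ↑ b · y · g)) ⟩
  partialLayer k b · (oneMinus y · oneMinus y) ⊕ (oneS ⊕ c) · (y ↑ b · y · g) · (oneMinus y · oneMinus y)
    ≈⟨ ⊕-congʳ _ (partialLayer-closed k b) ⟩
  g · (oneS ⊕ ⊖ y ⊕ y · y ⊕ ⊖ ((oneS ⊕ c) · (y ↑ b · y)) ⊕ c · (y ↑ b · y) · y) ⊕ (oneS ⊕ c) · (y ↑ b · y · g) · (oneMinus y · oneMinus y)
    ≈⟨ identity 4 (λ g y c w → let 𝟙 = con (+ 1) in
         g :* (𝟙 :- y :+ y :* y :- (𝟙 :+ c) :* (w :* y) :+ c :* (w :* y) :* y) :+ (𝟙 :+ c) :* (w :* y :* g) :* ((𝟙 :- y) :* (𝟙 :- y))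
         := g :* (𝟙 :- y :+ y :* y :- (𝟙 :+ (𝟙 :+ c)) :* (w :* y :* y) :+ (𝟙 :+ c) :* (w :* y :* y) :* y)) refl g y c (y ↑ b) ⟩
  g · (oneS ⊕ ⊖ y ⊕ y · y ⊕ ⊖ ((oneS ⊕ (oneS ⊕ c)) · (y ↑ suc b · y)) ⊕ (oneS ⊕ c) · (y ↑ suc b · y) · y)
    ≈⟨ ·-congˡ g (⊕-cong (⊕-congˡ _ (⊖-cong (·-congʳ (y ↑ suc b · y) (⊕-congˡ oneS c′≈)))) (·-congʳ y (·-congʳ (y ↑ suc b · y) c′≈))) ⟨
  g · (oneS ⊕ ⊖ y ⊕ y · y ⊕ ⊖ ((oneS ⊕ c′) · (y ↑ suc b · y)) ⊕ c′ · (y ↑ suc b · y) · y) ∎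
  where
  open ≈-Reasoning
  y = X ↑ suc k
  g = layer k
  c = constS (+ b)
  c′ = constS (+ suc b)
  c′≈ : c′ ≈ oneS ⊕ c
  c′≈ = ≈-trans (constS-+ (+ 1) (+ b)) (⊕-congʳ c (≈-sym (embed≈constS (+ 1))))

PDsum-drop : ∀ n k b → n ≤ b → PDsum n (suc k) k (suc b) ≡ PDsum n (suc k) k b
PDsum-drop n k b n≤b with suc b * suc k ℕₚ.≤? n
... | yes le = contradiction (ℕₚ.≤-trans (s≤s n≤b) (ℕₚ.≤-trans (ℕₚ.m≤m*n (suc b) (suc k)) le)) (ℕₚ.n≮n n)
... | no  _  = refl

PDsum-stable : ∀ n k {b} → n ≤ b → PDsum n (suc k) k b ≡ PDsum n (suc k) k n
PDsum-stable n k {b} n≤b = subst (λ b → PDsum n (suc k) k b ≡ PDsum n (suc k) k n) (ℕₚ.m∸n+n≡m n≤b) (go (b ∸ n))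
  where
  go : ∀ d → PDsum n (suc k) k (d + n) ≡ PDsum n (suc k) k n
  go zero    = refl
  go (suc d) = trans (PDsum-drop n k (d + n) (ℕₚ.m≤n+m n d)) (go d)

-- Below q^K fewer than K copies of the size k + 1 fit, so cutting at K loses nothing there, and the
-- error terms are divisible by y^(K+1).
layer-recurrence : ∀ k → let y = X ↑ suc k in layer (suc k) · (oneMinus y · oneMinus y) ≈ layer k · (oneS ⊕ ⊖ y ⊕ y · y)
layer-recurrence k = []⇒≈ λ K → let open SetoidReasoning ([]-setoid K) in begin
  layer (suc k) · (oneMinus y · oneMinus y)
    ≈⟨ ·-cong[] (mk[] λ n n<K → cong +_ (trans (layer-suc k n) (sym (PDsum-stable n k (ℕₚ.<⇒≤ n<K))))) []-refl ⟩
  partialLayer k K · (oneMinus y · oneMinus y)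
    ≈⟨ ≈⇒[] (partialLayer-closed k K) ⟩
  layer k · (oneS ⊕ ⊖ y ⊕ y · y ⊕ ⊖ ((oneS ⊕ constS (+ K)) · (y ↑ K · y)) ⊕ constS (+ K) · (y ↑ K · y) · y)
    ≈⟨ ·-cong[] []-refl (⊕-cong[] (⊕-cong[] []-refl (⊖-cong[] (·-cong[] []-refl (vanish K)))) (·-cong[] (·-cong[] []-refl (vanish K)) []-refl)) ⟩
  layer k · (oneS ⊕ ⊖ y ⊕ y · y ⊕ ⊖ ((oneS ⊕ constS (+ K)) · zeroS) ⊕ constS (+ K) · zeroS · y)
    ≈⟨ ≈⇒[] (identity 3 (λ g y c → let 𝟙 = con (+ 1) ; 𝟘 = con (+ 0) in
         g :* (𝟙 :- y :+ y :* y :- (𝟙 :+ c) :* 𝟘 :+ c :* 𝟘 :* y) := g :* (𝟙 :- y :+ y :* y)) refl (layer k) y (constS (+ K))) ⟩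
  layer k · (oneS ⊕ ⊖ y ⊕ y · y) ∎
  where
  y = X ↑ suc k
  vanish : ∀ K → y ↑ K · y ≈[ K ] zeroS
  vanish K = []-weaken (ℕₚ.m≤m+n K 0) (·-order {y ↑ K} {y} K 0 (↑-order K (X↑-order k)) (mk[] λ _ ()))

partialE-factor : ∀ d k → X ↑ d · (X ↑ d) ↑ k ≈ (X ↑ suc k) ↑ d
partialE-factor d k = ≈-trans (X↑-progression d k) (≈-trans (SR.reflexive (cong (X ↑_) (ℕₚ.*-comm (suc k) d))) (↑-* X d (suc k)))

-- Each step divides by (1 - y)², while E_1 occurs only once in the denominator. The additional
-- `partialE 1 k` on both sides provides the second 1 - y and is cancelled in the limit.
layer-product : ∀ k → layer k · partialE 1 k · partialE 2 k · partialE 3 k · partialE 1 k ≈ partialE 6 k · partialE 1 k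
layer-product zero = ≈-trans
  (identity 1 (λ g → let 𝟙 = con (+ 1) in g :* 𝟙 :* 𝟙 :* 𝟙 :* 𝟙 := g :* 𝟙) refl (layer 0))
  (·-congʳ oneS (mk≈ λ { zero → refl ; (suc _) → refl }))
layer-product (suc k) = begin
  layer (suc k) · (P 1 · F 1) · (P 2 · F 2) · (P 3 · F 3) · (P 1 · F 1)
    ≈⟨ ·-cong (·-cong (·-cong (·-congˡ (layer (suc k)) (·-congˡ (P 1) (F≈ 1))) (·-congˡ (P 2) (F≈ 2))) (·-congˡ (P 3) (F≈ 3))) (·-congˡ (P 1) (F≈ 1)) ⟩
  layer (suc k) · (P 1 · f 1) · (P 2 · f 2) · (P 3 · f 3) · (P 1 · f 1)
    ≈⟨ identity 5 (λ g y p q r → let 𝟙 = con (+ 1) ; f = λ d → 𝟙 :- y ↑ₚ d in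
         g :* (p :* f 1) :* (q :* f 2) :* (r :* f 3) :* (p :* f 1)
         := g :* ((𝟙 :- y) :* (𝟙 :- y)) :* (f 2 :* f 3 :* (p :* q :* r :* p))) refl (layer (suc k)) y (P 1) (P 2) (P 3) ⟩
  layer (suc k) · (oneMinus y · oneMinus y) · (f 2 · f 3 · (P 1 · P 2 · P 3 · P 1))
    ≈⟨ ·-congʳ _ (layer-recurrence k) ⟩
  layer k · (oneS ⊕ ⊖ y ⊕ y · y) · (f 2 · f 3 · (P 1 · P 2 · P 3 · P 1))
    ≈⟨ identity 5 (λ g y p q r → let 𝟙 = con (+ 1) ; f = λ d → 𝟙 :- y ↑ₚ d in
         g :* (𝟙 :- y :+ y :* y) :* (f 2 :* f 3 :* (p :* q :* r :* p))
         := g :* p :* q :* r :* p :* (f 6 :* f 1)) refl (layer k) y (P 1) (P 2) (P 3) ⟩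
  layer k · P 1 · P 2 · P 3 · P 1 · (f 6 · f 1)
    ≈⟨ ·-cong (layer-product k) (·-cong (≈-sym (F≈ 6)) (≈-sym (F≈ 1))) ⟩
  P 6 · P 1 · (F 6 · F 1)
    ≈⟨ identity 4 (λ a b c d → a :* b :* (c :* d) := a :* c :* (b :* d)) refl (P 6) (P 1) (F 6) (F 1) ⟩
  P 6 · F 6 · (P 1 · F 1) ∎
  where
  open ≈-Reasoning
  y = X ↑ suc k
  P F f : ℕ → Series
  P d = partialE d k
  F d = oneMinus (X ↑ d · (X ↑ d) ↑ k)
  f d = oneMinus (y ↑ d)
  F≈ : ∀ d → F d ≈ f d
  F≈ d = oneMinus-cong (partialE-factor d k)

PDle-drop : ∀ n k → n ≤ k → PDle n (suc k) ≡ PDle n k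
PDle-drop n k n≤k = trans (layer-suc k n) (go n)
  where
  go : ∀ b → PDsum n (suc k) k b ≡ PDle n k
  go zero    = refl
  go (suc b) with suc b * suc k ℕₚ.≤? n
  ... | yes le = contradiction (ℕₚ.≤-trans (s≤s n≤k) (ℕₚ.≤-trans (ℕₚ.m≤n*m (suc k) (suc b)) le)) (ℕₚ.n≮n n)
  ... | no  _  = go b

PDle-stable : ∀ n {k} → n ≤ k → PDle n k ≡ PD n
PDle-stable n {k} n≤k = subst (λ k → PDle n k ≡ PD n) (ℕₚ.m∸n+n≡m n≤k) (go (k ∸ n))
  where
  go : ∀ d → PDle n (d + n) ≡ PD n
  go zero    = refl
  go (suc d) = trans (PDle-drop n (d + n) (ℕₚ.m≤n+m n d)) (go d)

PDseries : Series
PDseries n = + PD n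

PDseries-product : PDseries · E 1 · E 2 · E 3 ≈ E 6
PDseries-product = ·-cancelʳ (E 1) (E-Inv 0) ([]⇒≈ λ K → []-trans
  (·-cong[] (·-cong[] (·-cong[] (·-cong[] (mk[] λ n n<K → cong +_ (sym (PDle-stable n (ℕₚ.<⇒≤ n<K))))
    (E-approx 0 ℕₚ.≤-refl)) (E-approx 1 ℕₚ.≤-refl)) (E-approx 2 ℕₚ.≤-refl)) (E-approx 0 ℕₚ.≤-refl))
  ([]-trans (≈⇒[] (layer-product K)) ([]-sym (·-cong[] (E-approx 5 ℕₚ.≤-refl) (E-approx 0 ℕₚ.≤-refl)))))

-- The residue class 2 and the quotient in the theorem

opaque
  unfolding _·_

  ⊛≈· : ∀ {a a′ b b′} → a ≈ a′ → b ≈ b′ → a ⊛ b ≈ a′ · b′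
  ⊛≈· = ·-cong

^S≈↑ : ∀ {a b} n → a ≈ b → a ^S n ≈ b ↑ n
^S≈↑ zero    p = ≈-refl
^S≈↑ (suc n) p = ⊛≈· (^S≈↑ n p) p

scale≈ : ∀ c a → scale c a ≈ constS c · a
scale≈ c a = mk≈ λ n → sym (constS-· c a n)

quotient-unique : ∀ {f} c a b → b 0 ≡ + 1 → f · b ≈ constS c · a → f ≈ scale c (a ⊛ inv b)
quotient-unique c a b b0 p = ·-cancelʳ b (inv b , inv-inverse b b0) (≈-trans p (≈-sym (begin
  scale c (a ⊛ inv b) · b           ≈⟨ ·-congʳ b (≈-trans (scale≈ c (a ⊛ inv b)) (·-congˡ (constS c) (⊛≈· ≈-refl ≈-refl))) ⟩
  constS c · (a · inv b) · b        ≈⟨ identity 4 (λ c a i b → c :* (a :* i) :* b := c :* (a :* (b :* i))) refl (constS c) a (inv b) b ⟩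
  constS c · (a · (b · inv b))      ≈⟨ ·-congˡ (constS c) (≈-trans (·-congˡ a (inv-inverse b b0)) (·-identityʳ a)) ⟩
  constS c · a                      ∎)))
  where open ≈-Reasoning

-- Multiplied by E_2 and rewritten with `odd d` = E_d / E_{2d}, the claim becomes G₂ E_1⁵ E_2⁴ = 3
-- E_2 E_3³ E_6³. Here E_1⁴ E_2⁴ comes from the norm, and the fifth E_1 is the E_3 of the generating
-- function seen through q³.
U₂-PD : U 2 PDseries · (odd 1 ↑ 5 · E 2 ↑ 8) ≈ constS (+ 3) · (odd 3 ↑ 3 · E 6 ↑ 6)
U₂-PD = ·-cancelʳ (E 2) (E-Inv 1) (begin
  G₂ · (odd 1 ↑ 5 · E 2 ↑ 8) · E 2
    ≈⟨ identity 3 (λ g o e → g :* (o ↑ₚ 5 :* e ↑ₚ 8) :* e := g :* ((o :* e) ↑ₚ 4 :* e ↑ₚ 4) :* (o :* e)) refl G₂ (odd 1) (E 2) ⟩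
  G₂ · ((odd 1 · E 2) ↑ 4 · E 2 ↑ 4) · (odd 1 · E 2)
    ≈⟨ ·-cong (·-congˡ G₂ (·-congʳ (E 2 ↑ 4) (↑-cong 4 (odd·E 0)))) (odd·E 0) ⟩
  G₂ · (E 1 ↑ 4 · E 2 ↑ 4) · E 1
    ≈⟨ ·-congʳ (E 1) (·-congˡ G₂ norm-E₁E₂) ⟨
  G₂ · (norm f · (E 3 · E 6)) · E 1
    ≈⟨ identity 4 (λ g n e h → g :* (n :* e) :* h := n :* h :* g :* e) refl G₂ (norm f) (E 3 · E 6) (E 1) ⟩
  norm f · E 1 · G₂ · (E 3 · E 6)
    ≈⟨ ·-congʳ (E 3 · E 6) residue ⟩
  E 2 · (constS (+ 3) · (E 3 · E 6 · (E 3 · E 6))) · (E 3 · E 6)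
    ≈⟨ identity 3 (λ e f g → e :* (con (+ 3) :* (f :* g :* (f :* g))) :* (f :* g) := con (+ 3) :* (f ↑ₚ 3 :* g ↑ₚ 3) :* e) refl (E 2) (E 3) (E 6) ⟩
  constS (+ 3) · (E 3 ↑ 3 · E 6 ↑ 3) · E 2
    ≈⟨ ·-congʳ (E 2) (·-congˡ (constS (+ 3)) (·-congʳ (E 6 ↑ 3) (↑-cong 3 (odd·E 2)))) ⟨
  constS (+ 3) · ((odd 3 · E 6) ↑ 3 · E 6 ↑ 3) · E 2
    ≈⟨ identity 3 (λ o e f → con (+ 3) :* ((o :* e) ↑ₚ 3 :* e ↑ₚ 3) :* f := con (+ 3) :* (o ↑ₚ 3 :* e ↑ₚ 6) :* f) refl (odd 3) (E 6) (E 2) ⟩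
  constS (+ 3) · (odd 3 ↑ 3 · E 6 ↑ 6) · E 2 ∎)
  where
  open ≈-Reasoning
  f = E 1 · E 2
  a = U 0 f
  b = U 1 f
  c = U 2 f
  G₂ = U 2 PDseries
  conjugate : Series
  conjugate = dissected (a · a ⊕ ⊖ (X · b · c)) (X · c · c ⊕ ⊖ (a · b)) (b · b ⊕ ⊖ (a · c))
  dissected-PD : T (norm f · E 1) · PDseries ≈ T (E 2) · conjugate
  dissected-PD = begin
    T (norm f · E 1) · PDseries
      ≈⟨ ·-congʳ PDseries (≈-trans (T-· (norm f) (E 1)) (·-cong (≈-sym (≈-trans (·-congʳ conjugate (dissect f)) (dissected-conjugate a b c))) (T-E 0))) ⟩
    f · conjugate · E 3 · PDseries
      ≈⟨ identity 5 (λ e₁ e₂ k e₃ g → e₁ :* e₂ :* k :* e₃ :* g := g :* e₁ :* e₂ :* e₃ :* k) refl (E 1) (E 2) conjugate (E 3) PDseries ⟩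
    PDseries · E 1 · E 2 · E 3 · conjugate
      ≈⟨ ·-congʳ conjugate (≈-trans PDseries-product (≈-sym (T-E 1))) ⟩
    T (E 2) · conjugate ∎
  residue : norm f · E 1 · G₂ ≈ E 2 · (constS (+ 3) · (E 3 · E 6 · (E 3 · E 6)))
  residue = begin
    norm f · E 1 · G₂                      ≈⟨ U₂-T (norm f · E 1) PDseries ⟨
    U 2 (T (norm f · E 1) · PDseries)      ≈⟨ U-cong 2 dissected-PD ⟩
    U 2 (T (E 2) · conjugate)              ≈⟨ U₂-T (E 2) conjugate ⟩
    E 2 · U 2 conjugate                    ≈⟨ ·-congˡ (E 2) (≈-trans (U-dissected₂ ≈-refl) E₁E₂-discriminant) ⟩
    E 2 · (constS (+ 3) · (E 3 · E 6 · (E 3 · E 6))) ∎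

powers≈ : ∀ a b a′ b′ m n → a ≈ a′ → b ≈ b′ → (a ^S m) ⊛ (b ^S n) ≈ a′ ↑ m · b′ ↑ n
powers≈ a b a′ b′ m n p q = ⊛≈· {a ^S m} {a′ ↑ m} {b ^S n} {b′ ↑ n} (^S≈↑ m p) (^S≈↑ n q)

powers-zero : ∀ a b m n → a 0 ≡ + 1 → b 0 ≡ + 1 → ((a ^S m) ⊛ (b ^S n)) 0 ≡ + 1
powers-zero a b m n p q = ⊛-one (a ^S m) (b ^S n) (^S-one a m p) (^S-one b n q)
  where
  ⊛-one : ∀ a b → a 0 ≡ + 1 → b 0 ≡ + 1 → (a ⊛ b) 0 ≡ + 1
  ⊛-one a b p q = trans (ℤₚ.+-identityˡ (a 0 *ℤ b 0)) (cong₂ _*ℤ_ p q)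
  ^S-one : ∀ a n → a 0 ≡ + 1 → (a ^S n) 0 ≡ + 1
  ^S-one a zero    p = refl
  ^S-one a (suc n) p = ⊛-one (a ^S n) a (^S-one a n p) p

U₂-PD-quotient : U 2 PDseries ≈ scale (+ 3)
  ((poch 3 6 ^S 3) ⊛ (poch 6 6 ^S 6) ⊛ inv ((poch 1 2 ^S 5) ⊛ (poch 2 2 ^S 8)))
U₂-PD-quotient = quotient-unique (+ 3) ((poch 3 6 ^S 3) ⊛ (poch 6 6 ^S 6)) ((poch 1 2 ^S 5) ⊛ (poch 2 2 ^S 8))
  (powers-zero (poch 1 2) (poch 2 2) 5 8 refl refl)
  (≈-trans (·-congˡ (U 2 PDseries) (powers≈ (poch 1 2) (poch 2 2) (odd 1) (E 2) 5 8 (poch≈prod∞ 0 2) (poch≈prod∞ 1 2)))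
    (≈-trans U₂-PD (≈-sym (·-congˡ (constS (+ 3)) (powers≈ (poch 3 6) (poch 6 6) (odd 3) (E 6) 3 6 (poch≈prod∞ 2 6) (poch≈prod∞ 5 6))))))

theorem1p3 : (n : ℕ) →
    + PD (3 * n + 2)
    ≡ scale (+ 3)
    ((poch 3 6 ^S 3) ⊛ (poch 6 6 ^S 6)
    ⊛ inv ((poch 1 2 ^S 5) ⊛ (poch 2 2 ^S 8))) n
theorem1p3 n = trans (cong (λ m → + PD m) (trans (ℕₚ.+-comm (3 * n) 2) (cong (λ m → 2 + m) (ℕₚ.*-comm 3 n)))) (at U₂-PD-quotient n)
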